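{- Let $G$ be an $n$-vertex descendant graph of a rooted tree $T$ with root $r$ and depth $d$. Let the vertices of $G$ be $n$ agents sharing the cake $[0,1]$, each agent $i$ having an integrable non-negative density $v_i$ on $[0,1]$ and valuation $V_i(S)=\int_S v_i(x)\,dx$. Then the algorithm $\mathrm{AlgDescendantGraph}(G)$ (described in the context) outputs an allocation $(A_i)_i$ of the cake that is proportional on $G$, i.e. $V_i(A_i)\ge \frac{1}{|N(i)|}\sum_{j\in N(i)}V_i(A_j)$ for every agent $i$, where $N(i)$ is the set of neighbors of $i$ in $G$, and it uses at most $n^2\cdot d!$ cuts.
   Context: **Cake cutting.** The cake is the interval $[0,1]$. There are $n$ agents; agent $i$ has an integrable non-negative density function $v_i$ on $[0,1]$. A piece is a finite union of disjoint intervals of $[0,1]$, and agent $i$ values a piece $S$ at $V_i(S)=\int_S v_i(x)\,dx$. An allocation is a partition of $[0,1]$ into $n$ disjoint pieces $(A_1,\dots,A_n)$, agent $i$ receiving $A_i$. A cut is a division of the cake at one point; the number of cuts of an algorithm is the total number of cuts made during its execution. **Proportionality on a graph.** For an undirected simple graph $G$ whose vertices are the agents, an allocation is proportional on $G$ if for every $i$, $V_i(A_i)\ge \frac{1}{|N(i)|}\sum_{j\in N(i)}V_i(A_j)$. For a vertex with no neighbors (which occurs here only if $n=1$) the condition is regarded as vacuous. **Descendant graph.** An undirected graph $G=(V,E)$ is a descendant graph on a rooted tree $T$ with root $r$ if $T$ is a spanning tree of $G$ and, for any two vertices $i,j$, $(i,j)\in E$ if and only if one of $i,j$ is a proper ancestor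 of the other in $T$ rooted at $r$. That is, $G$ is obtained from $T$ by connecting all ancestor-descendant pairs. **Notation.** For a vertex $v$ of $T$, $d(v)$ is its depth (the number of edges on the path from $v$ to the root $r$), $d=\max_v d(v)$ is the depth of $T$, $T(v)$ is the subtree rooted at $v$ ($v$ and its descendants), and $|T(v)|$ is its number of vertices. Define $$f(v)=\frac{d(v)+|T(v)|}{d(v)+1}\cdot d!.$$ (This is a positive integer, divisible by $d(v)$ whenever $d(v)\ge 1$.) **Algorithm $\mathrm{AlgDescendantGraph}(G)$.** Initially the root $r$ possesses the whole cake and every other vertex possesses nothing. Process the vertices $u$ of $T$ in increasing order of depth $d(u)$ (ties in any order). When $u$ is processed: 1. (Collect) Let $X^u$ be the union of all cake pieces that $u$ currently possesses. 2. (Cut) Agent $u$ slices $X^u$ into $f(u)$ pieces $X^u_1,\dots,X^u_{f(u)}$ of equal value with respect to $V_u$. 3. (Distribute) For each $v\in T(u)\setminus\{u\}$ in increasing order of $d(v)$ (ties in any order): among the pieces of $X^u_1,\dots,X^u_{f(u)}$ not yet taken, agent $v$ takes $f(v)/d(v)$ pieces that she values the highest (ties broken arbitrarily). The pieces left at the end stay with $u$. The output is the allocation in which each agent gets what she possesses when all vertices have been processed. -}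

module Defs where

open import Level using (0ℓ)
open import Axiom.ExcludedMiddle using (ExcludedMiddle)
open import Algebra.Core using (Op₁; Op₂)
open import Algebra.Structures using (IsCommutativeRing)
open import Data.Empty using (⊥)
open import Data.Fin.Base using (Fin)
open import Data.List.Base using (List; []; _∷_; _++_; concat; foldr; map; filter; length; allFin)
import Data.List.Extrema.Nat as Extrema
open import Data.List.Membership.Propositional using (_∈_)
open import Data.List.Relation.Binary.Permutation.Propositional using (_↭_)
open import Data.List.Relation.Unary.All using (All)
open import Data.List.Relation.Unary.AllPairs using (AllPairs)
open import Data.List.Relation.Unary.Any using (Any)
open import Data.List.Relation.Unary.Unique.Propositional using (Unique)
open import Data.Maybe.Base using (Maybe; just; nothing)
import Data.Nat.Base as ℕ
open ℕ using (ℕ; zero; suc; _!)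
open import Data.Product.Base using (Σ; ∃; ∃₂; _×_; _,_; proj₁; proj₂)
open import Data.Sum.Base using (_⊎_; inj₁; inj₂)
open import Data.Unit.Base using (⊤)
import Data.Vec.Functional as Vector
open import Function.Bundles using (_⇔_)
open import Function.Definitions using (Congruent)
open import Relation.Binary.Core using (Rel)
open import Relation.Binary.Construct.Closure.Transitive using (TransClosure)
import Relation.Binary.Construct.NonStrictToStrict as NonStrictToStrict
open import Relation.Binary.PropositionalEquality.Core using (_≡_; _≢_)
open import Relation.Binary.Structures using (IsTotalOrder)
open import Relation.Nullary using (¬_; yes; no)

-- The real numbers, given by their characterisation (unique up to isomorphism)
-- as a complete ordered field.  Equality is a setoid equality so that
-- constructions by Cauchy sequences or Dedekind cuts are instances.
record CompleteOrderedField : Set₁ where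
  infix  4 _≈_ _≤_
  infixl 6 _+_
  infixl 7 _*_
  infix  8 -_ _⁻¹
  field
    ℝ       : Set
    _≈_ _≤_ : Rel ℝ 0ℓ
    _+_ _*_ : Op₂ ℝ
    -_      : Op₁ ℝ
    0# 1#   : ℝ
    _⁻¹     : Op₁ ℝ
    isCommutativeRing : IsCommutativeRing _≈_ _+_ _*_ -_ 0# 1#
    isTotalOrder      : IsTotalOrder _≈_ _≤_

  open NonStrictToStrict _≈_ _≤_ public using (_<_)

  field
    0<1      : 0# < 1#
    -- The value of 0# ⁻¹ is unspecified.
    *-inverse : ∀ x → ¬ (x ≈ 0#) → x * x ⁻¹ ≈ 1#
    +-mono-≤  : ∀ x y z → x ≤ y → x + z ≤ y + z
    *-nonNeg  : ∀ x y → 0# ≤ x → 0# ≤ y → 0# ≤ x * y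
    supremum  : (P : ℝ → Set) → ∃ P → (∃ λ b → ∀ x → P x → x ≤ b) →
                ∃ λ s → (∀ x → P x → x ≤ s) ×
                        (∀ b → (∀ x → P x → x ≤ b) → s ≤ b)

  fromℕ : ℕ → ℝ
  fromℕ zero    = 0#
  fromℕ (suc n) = 1# + fromℕ n

  sum : List ℝ → ℝ
  sum = foldr _+_ 0#

-- Every sequence of steps from the given state that is continued for as long
-- as possible reaches, after finitely many steps, a state satisfying Post.
data Inevitably {S : Set} (_⟶_ : Rel S 0ℓ) (Post : S → Set) (s : S) : Set where
  now   : Post s → Inevitably _⟶_ Post s
  later : ∃ (λ s′ → s ⟶ s′) → (∀ s′ → s ⟶ s′ → Inevitably _⟶_ Post s′) →
          Inevitably _⟶_ Post s

record SimpleGraph (n : ℕ) : Set₁ where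
  infix 4 _~_
  field
    _~_    : Rel (Fin n) 0ℓ
    sym    : ∀ {i j} → i ~ j → j ~ i
    irrefl : ∀ {i} → ¬ (i ~ i)

-- PathToRoot r parent v k : the path from v to r has k edges.
data PathToRoot {n : ℕ} (r : Fin n) (parent : Fin n → Maybe (Fin n)) : Fin n → ℕ → Set where
  here : PathToRoot r parent r 0
  up   : ∀ {v p k} → parent v ≡ just p → PathToRoot r parent p k →
         PathToRoot r parent v (suc k)

record RootedTree (n : ℕ) : Set where
  field
    root        : Fin n
    parent      : Fin n → Maybe (Fin n)
    parent-root : parent root ≡ nothing
    path        : ∀ v → ∃ (PathToRoot root parent v)

  depth : Fin n → ℕ
  depth v = proj₁ (path v)

  treeDepth : ℕ
  treeDepth = Extrema.max 0 (map depth (allFin n))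

  infix 4 _ParentOf_ _AncestorOf_

  _ParentOf_ : Rel (Fin n) 0ℓ
  p ParentOf v = parent v ≡ just p

  -- Proper ancestors.
  _AncestorOf_ : Rel (Fin n) 0ℓ
  _AncestorOf_ = TransClosure _ParentOf_

record IsDescendantGraph {n : ℕ} (G : SimpleGraph n) (T : RootedTree n) : Set where
  open SimpleGraph G
  open RootedTree T
  field
    spanning : ∀ {p v} → p ParentOf v → p ~ v
    edges    : ∀ i j → (i ~ j) ⇔ (i AncestorOf j ⊎ j AncestorOf i)

-- xs lists exactly the vertices satisfying P, without repetition and in
-- non-decreasing order of depth.
record ByDepth {n : ℕ} (T : RootedTree n) (P : Fin n → Set) (xs : List (Fin n)) : Set where
  open RootedTree T
  field
    unique   : Unique xs
    exactly  : ∀ v → (v ∈ xs) ⇔ P v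
    ordered  : AllPairs (λ v w → depth v ℕ.≤ depth w) xs

module CakeCutting (lem : ExcludedMiddle 0ℓ) (𝓡 : CompleteOrderedField) where

  open CompleteOrderedField 𝓡 public

  private
    module ≤ = IsTotalOrder isTotalOrder

  -- Integration is the gauge (Henstock–Kurzweil) integral.  It extends the
  -- Riemann integral, and a non-negative function is gauge integrable exactly
  -- if it is Lebesgue integrable, with the same integral.

  data TaggedPartition : ℝ → ℝ → Set where
    end  : ∀ {a b} → a ≈ b → TaggedPartition a b
    cell : ∀ {a b} (c t : ℝ) → a ≤ t → t ≤ c → TaggedPartition c b → TaggedPartition a b

  riemannSum : ∀ {a b} → (ℝ → ℝ) → TaggedPartition a b → ℝ
  riemannSum         f (end _)          = 0#
  riemannSum {a = a} f (cell c t _ _ P) = f t * (c + - a) + riemannSum f P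

  record Gauge : Set where
    field
      δ    : ℝ → ℝ
      cong : Congruent _≈_ _≈_ δ
      pos  : ∀ x → 0# < δ x

  Fine : ∀ {a b} → Gauge → TaggedPartition a b → Set
  Fine         γ (end _)          = ⊤
  Fine {a = a} γ (cell c t _ _ P) = t < a + δ t × c < t + δ t × Fine γ P
    where open Gauge γ

  HasIntegral : (ℝ → ℝ) → ℝ → ℝ → ℝ → Set
  HasIntegral f a b I =
    ∀ ε → 0# < ε → Σ Gauge λ γ → (P : TaggedPartition a b) → Fine γ P →
      riemannSum f P ≤ I + ε × I ≤ riemannSum f P + ε

  Integrable : (ℝ → ℝ) → ℝ → ℝ → Set
  Integrable f a b = ∃ (HasIntegral f a b)

  -- The junk value 0# is given to non-integrable functions.
  ∫ : (ℝ → ℝ) → ℝ → ℝ → ℝ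
  ∫ f a b with lem {Integrable f a b}
  ... | yes (I , _) = I
  ... | no  _       = 0#

  -- Only the restriction of v to [0,1] matters.
  record Density : Set where
    field
      v          : ℝ → ℝ
      cong       : Congruent _≈_ _≈_ v
      nonNeg     : ∀ x → 0# ≤ x → x ≤ 1# → 0# ≤ v x
      integrable : Integrable v 0# 1#

  -- The interval [lo , hi), or [lo , 1] if hi is 1.  With this convention
  -- cutting at an interior point divides an interval into two disjoint
  -- intervals, the point going to the right-hand one.
  record Interval : Set where
    field
      lo hi : ℝ
      0≤lo  : 0# ≤ lo
      lo<hi : lo < hi
      hi≤1  : hi ≤ 1#

  open Interval

  infix 4 _∈ᴵ_ _∈ᴾ_

  _∈ᴵ_ : ℝ → Interval → Set
  x ∈ᴵ J = lo J ≤ x × (x < hi J ⊎ (x ≈ hi J × hi J ≈ 1#))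

  whole : Interval
  whole = record { lo = 0# ; hi = 1# ; 0≤lo = ≤.refl ; lo<hi = 0<1 ; hi≤1 = ≤.refl }

  leftOf rightOf : (J : Interval) (c : ℝ) → lo J < c → c < hi J → Interval
  leftOf J c lo<c c<hi = record
    { lo = lo J ; hi = c ; 0≤lo = 0≤lo J ; lo<hi = lo<c
    ; hi≤1 = ≤.trans (proj₁ c<hi) (hi≤1 J) }
  rightOf J c lo<c c<hi = record
    { lo = c ; hi = hi J ; 0≤lo = ≤.trans (0≤lo J) (proj₁ lo<c) ; lo<hi = c<hi
    ; hi≤1 = hi≤1 J }

  -- The union of the intervals listed; these are required to be disjoint in
  -- IsAllocation.
  Piece : Set
  Piece = List Interval

  _∈ᴾ_ : ℝ → Piece → Set
  x ∈ᴾ X = Any (x ∈ᴵ_) X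

  value : Density → Piece → ℝ
  value D X = sum (map (λ J → ∫ (Density.v D) (lo J) (hi J)) X)

  -- Cuts m X Y : m cuts, each at an interior point of some interval, turn the
  -- intervals of X into those of Y.
  data Cuts : ℕ → Piece → Piece → Set where
    none : ∀ {X} → Cuts 0 X X
    cut  : ∀ {m Y} Xˡ J Xʳ c (lo<c : lo J < c) (c<hi : c < hi J) →
           Cuts m (Xˡ ++ leftOf J c lo<c c<hi ∷ rightOf J c lo<c c<hi ∷ Xʳ) Y →
           Cuts (suc m) (Xˡ ++ J ∷ Xʳ) Y

  Shares : ℕ → Set
  Shares n = Vector.Vector Piece n

  record IsAllocation {n : ℕ} (A : Shares n) : Set where
    field
      pieces   : ∀ i → AllPairs (λ J K → ∀ x → x ∈ᴵ J → x ∈ᴵ K → ⊥) (A i)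
      disjoint : ∀ i j → i ≢ j → ∀ x → x ∈ᴾ A i → x ∈ᴾ A j → ⊥
      covering : ∀ x → 0# ≤ x → x ≤ 1# → ∃ λ i → x ∈ᴾ A i

  select : {n : ℕ} → (Fin n → Set) → List (Fin n)
  select {n} P = filter (λ i → lem {P i}) (allFin n)

  ProportionalOn : {n : ℕ} → SimpleGraph n → (Fin n → Density) → Shares n → Set
  ProportionalOn {n} G D A =
    ∀ i → N i ≢ [] →
      fromℕ (length (N i)) ⁻¹ * sum (map (λ j → value (D i) (A j)) (N i)) ≤ value (D i) (A i)
    where
    open SimpleGraph G
    N : Fin n → List (Fin n)
    N i = select (λ j → i ~ j)

  module AlgDescendantGraph {n : ℕ} (T : RootedTree n) (D : Fin n → Density) where

    open RootedTree T

    V : Fin n → Piece → ℝ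
    V i = value (D i)

    subtreeSize : Fin n → ℕ
    subtreeSize v = length (select (λ w → w ≡ v ⊎ v AncestorOf w))

    -- The division is exact: depth v + 1 divides treeDepth ! unless v is a
    -- deepest leaf, and then the first factor is depth v + 1.
    f : Fin n → ℕ
    f v = ((depth v ℕ.+ subtreeSize v) ℕ.* treeDepth !) ℕ./ suc (depth v)

    give : Fin n → Piece → Shares n → Shares n
    give v X A = Vector.updateAt A v (X ++_)

    nothingShared : Shares n
    nothingShared _ = []

    -- A : what the vertices possess;  k : the number of cuts made so far.
    data State : Set where
      start   : State
      -- The vertices us are still to be processed.
      ready   : (us : List (Fin n)) (A : Shares n) (k : ℕ) → State
      -- The pieces Xs sliced by u are still on the table, the vertices vs are
      -- still to take from them, and then the vertices us are to be processed.
      sharing : (u : Fin n) (Xs : List Piece) (vs us : List (Fin n)) (A : Shares n) (k : ℕ) → State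

    infix 4 _⟶_

    data _⟶_ : Rel State 0ℓ where

      begin : ∀ {us} → ByDepth T (λ _ → ⊤) us →
              start ⟶ ready us (give root (whole ∷ []) nothingShared) 0

      -- Slicing into f u pieces takes at most f u − 1 cuts: the intervals can
      -- be laid side by side.  Which points are cut, and how the resulting
      -- intervals are grouped into pieces of equal value, is left open.
      slice : ∀ {u us A k m Y Xs vs} →
              Cuts m (A u) Y → m ℕ.< f u →
              concat Xs ↭ Y → length Xs ≡ f u →
              (∃ λ w → All (λ X → V u X ≈ w) Xs) →
              ByDepth T (u AncestorOf_) vs →
              ready (u ∷ us) A k ⟶
              sharing u Xs vs us (Vector.updateAt A u (λ _ → [])) (k ℕ.+ m)

      -- v takes f v / depth v pieces Ys and leaves the pieces Zs.
      take  : ∀ {u Xs Ys Zs v vs us A k} →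
              Xs ↭ Ys ++ Zs →
              length Ys ℕ.* depth v ≡ f v →
              All (λ Y → All (λ Z → V v Z ≤ V v Y) Zs) Ys →
              sharing u Xs (v ∷ vs) us A k ⟶
              sharing u Zs vs us (give v (concat Ys) A) k

      keep  : ∀ {u Xs us A k} →
              sharing u Xs [] us A k ⟶ ready us (give u (concat Xs) A) k

    -- Every execution terminates, without getting stuck, with an output A
    -- and a number of cuts k satisfying Q (no step leads from ready [] A k).
    Ensures : (Shares n → ℕ → Set) → Set
    Ensures Q = Inevitably _⟶_ (λ s → ∃₂ λ A k → s ≡ ready [] A k × Q A k) start

{-# OPTIONS --safe #-}

module Submission where

open import Defs
open import Level using (0ℓ)
open import Algebra.Bundles using (CommutativeMonoid; CommutativeRing)
import Algebra.Solver.Ring as RingSolver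
open import Algebra.Solver.Ring.AlmostCommutativeRing using (fromCommutativeRing; _-Raw-AlmostCommutative⟶_)
open import Axiom.ExcludedMiddle using (ExcludedMiddle)
open import Data.Empty using (⊥; ⊥-elim)
open import Data.Fin.Base using (Fin; zero; suc; punchIn)
open import Data.Fin.Properties using (punchInᵢ≢i)
import Data.Integer.Base as ℤ
import Data.Integer.Properties as ℤₚ
open import Data.List.Base as List using (List; []; _∷_; _++_; concat; foldr; map; filter; length; allFin)
import Data.List.Extrema.Nat as Extrema
open import Data.List.Membership.Propositional using (_∈_; _∉_; find)
open import Data.List.Membership.Propositional.Properties using (∈-allFin; ∈-map⁺; ∈-++⁺ˡ; ∈-++⁺ʳ; ∈-filter⁺; ∈-filter⁻)
import Data.List.Properties as Listₚ
open import Data.List.Relation.Binary.Permutation.Propositional as Perm using (_↭_; ↭-refl; ↭-sym; ↭-trans; ↭-reflexive; prep; swap)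
import Data.List.Relation.Binary.Permutation.Propositional.Properties as Permₚ
open import Data.List.Relation.Unary.All as All using (All; []; _∷_)
import Data.List.Relation.Unary.All.Properties as Allₚ
open import Data.List.Relation.Unary.AllPairs as AllPairs using (AllPairs; []; _∷_)
open import Data.List.Relation.Unary.Any using (Any; here; there)
open import Data.List.Relation.Unary.Any.Properties as Anyₚ using (¬Any[])
open import Data.List.Relation.Unary.Linked.Properties using (Linked⇒AllPairs)
open import Data.List.Relation.Unary.Unique.Propositional using (Unique)
import Data.List.Relation.Unary.Unique.Propositional.Properties as Uniqueₚ
import Data.List.Sort as Sort
open import Data.Maybe.Base using (Maybe; just; nothing)
import Data.Maybe.Properties as Maybe
open import Data.Nat.Base as ℕ using (ℕ; zero; suc; _^_; _!)
open import Data.Nat.Divisibility using (_∣_; divides; ∣-trans; m≤n⇒m!∣n!; ∣m⇒∣m*n; ∣n⇒∣m*n; m∣m*n)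
open import Data.Nat.DivMod using (m/n*n≡m; m/n≤m)
import Data.Nat.Properties as ℕₚ
import Data.Nat.Solver as ℕSolver
open import Data.Product.Base using (Σ; ∃; ∃₂; _×_; _,_; proj₁; proj₂)
open import Data.Sum.Base using (_⊎_; inj₁; inj₂; [_,_]′)
open import Data.Unit.Base using (⊤; tt)
open import Data.Vec.Functional as Vector using (Vector; removeAt)
open import Data.Vec.Functional.Properties using (updateAt-updates; updateAt-minimal)
open import Function.Base using (_∘_)
open import Function.Bundles using (mk⇔; module Equivalence)
open import Relation.Binary.Bundles using (TotalOrder; DecTotalOrder)
open import Relation.Binary.Construct.Closure.Transitive as Plus using ([_]; _∷_)
import Relation.Binary.Construct.Flip.EqAndOrd as Flip
import Relation.Binary.Construct.NonStrictToStrict as NonStrictToStrict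
import Relation.Binary.Construct.On as On
open import Relation.Binary.Core using (Rel)
open import Relation.Binary.Definitions using (Symmetric)
open import Relation.Binary.PropositionalEquality.Core as ≡ using (_≡_; _≢_; refl)
open import Relation.Binary.PropositionalEquality.Properties using (module ≡-Reasoning)
open import Relation.Nullary using (¬_; Dec; yes; no)

-- Fix an agent i.  She takes f(i)/d(i) pieces from each proper ancestor u, each of which she values at
-- least as much as any piece still on the table.  Since f(u) = d! + Σ f(v)/d(v) over the proper descendants
-- v of u, for every u, the d! pieces that u keeps and the pieces that T(i)∖{i} takes from u are at most f(i)
-- pieces, hence worth to her at most d(i) times what she takes from u.  So before i is processed, the
-- cake of T(i) and of the processed ancestors of i is worth at most (d(i) + 1) V_i(A_i) to her.  Processing i
-- leaves her d! of f(i) = (d(i) + |T(i)|) d! / (d(i) + 1) equal pieces, which turns the factor d(i) + 1 into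
-- d(i) + |T(i)| = |N(i)| + 1.
--
-- The formula for f(u) is a double count of the pairs u < v ≤ w, as 1/(d(v)(d(v) + 1)) telescopes along
-- paths.  Equal slices exist by the intermediate value theorem for the indefinite integral.

-- Sums of indicator functions

-- The order of distribution carries the argument: takers come by increasing depth, so `i` chooses
-- before all of her descendants, and whatever they or `u` end up with from the table was still
-- there after her choice. The obstacle is that the bound must hold in the middle of a distribution,
-- when the table belongs to nobody and later takers may choose anything. The invariant therefore
-- charges the table in two ways. The slicer `u` and her ancestors charge all of it, since it stays
-- in their subtrees. A descendant who has taken charges only the number of pieces bound for `u` and
-- for her own subtree, at a fixed price per piece: the value of the least piece that she took.
-- Pieces going elsewhere never enter her account. The numbers of pieces fit this account: `d(i)`
-- times the number that she takes is `f(i)`, which covers the pieces charged. Slices and ties are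
-- left open by the algorithm, so the invariant is shown for every state that a run can reach.

module IndicatorSum {c ℓ} (M : CommutativeMonoid c ℓ) where
  open CommutativeMonoid M renaming (_∙_ to _+_; ε to 0#; refl to ≈refl)
  open import Algebra.Properties.CommutativeMonoid.Sum M
  open import Relation.Binary.Reasoning.Setoid setoid

  when : {P : Set} → Dec P → Carrier → Carrier
  when (yes _) x = x
  when (no _)  _ = 0#

  when-yes : {P : Set} (P? : Dec P) {x : Carrier} → P → when P? x ≈ x
  when-yes (yes _) _ = ≈refl
  when-yes (no ¬p) p = ⊥-elim (¬p p)

  when-no : {P : Set} (P? : Dec P) {x : Carrier} → ¬ P → when P? x ≈ 0#
  when-no (yes p) ¬p = ⊥-elim (¬p p)
  when-no (no _)  _  = ≈refl

  when-cong : {P Q : Set} (P? : Dec P) (Q? : Dec Q) {x y : Carrier} →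
              (P → Q) → (Q → P) → (P → x ≈ y) → when P? x ≈ when Q? y
  when-cong (yes p) Q? to from x≈y = trans (x≈y p) (sym (when-yes Q? (to p)))
  when-cong (no ¬p) Q? to from x≈y = sym (when-no Q? (¬p ∘ from))

  when-0 : {P : Set} (P? : Dec P) {x : Carrier} → x ≈ 0# → when P? x ≈ 0#
  when-0 (yes _) x≈0 = x≈0
  when-0 (no _)  _   = ≈refl

  when-+ : {P : Set} (P? : Dec P) (x y : Carrier) → when P? (x + y) ≈ when P? x + when P? y
  when-+ (yes _) x y = ≈refl
  when-+ (no _)  x y = sym (identityˡ 0#)

  when-⊎ : {P Q R : Set} (P? : Dec P) (Q? : Dec Q) (R? : Dec R) (x : Carrier) →
           (R → P ⊎ Q) → (P ⊎ Q → R) → ¬ (P × Q) → when R? x ≈ when P? x + when Q? x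
  when-⊎ (yes p) (yes q) R? x to from disj = ⊥-elim (disj (p , q))
  when-⊎ (yes p) (no _)  R? x to from disj = trans (when-yes R? (from (inj₁ p))) (sym (identityʳ x))
  when-⊎ (no _)  (yes q) R? x to from disj = trans (when-yes R? (from (inj₂ q))) (sym (identityˡ x))
  when-⊎ (no ¬p) (no ¬q) R? x to from disj =
    trans (when-no R? (λ r → [ ¬p , ¬q ]′ (to r))) (sym (identityˡ 0#))

  sum-0 : ∀ {n} {x : Vector Carrier n} → (∀ i → x i ≈ 0#) → sum x ≈ 0#
  sum-0 {n} x≈0 = trans (sum-cong-≋ x≈0) (sum-replicate-zero n)

  when-sum : {P : Set} (P? : Dec P) {n : ℕ} (x : Vector Carrier n) →
             when P? (sum x) ≈ sum (λ i → when P? (x i))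
  when-sum (yes _) x = ≈refl
  when-sum (no _)  {n} x = sym (sum-replicate-zero n)

  -- One index is taken out of both sums. The surplus `a` is what a vertex receives or loses, or the
  -- new term when an index set gains `v`.
  sum-update : ∀ {n} {x y : Vector Carrier n} {a : Carrier} v → (∀ j → j ≢ v → x j ≈ y j) →
               x v ≈ a + y v → sum x ≈ a + sum y
  sum-update {suc n} {x} {y} {a} v x≈y xv≈ = begin
    sum x                          ≈⟨ sum-remove {i = v} x ⟩
    x v + sum (removeAt x v)       ≈⟨ ∙-cong xv≈ (sum-cong-≋ λ j → x≈y (punchIn v j) (punchInᵢ≢i v j)) ⟩
    (a + y v) + sum (removeAt y v) ≈⟨ assoc a _ _ ⟩
    a + (y v + sum (removeAt y v)) ≈⟨ ∙-congˡ (sum-remove {i = v} y) ⟨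
    a + sum y                      ∎

  sumᴸ : List Carrier → Carrier
  sumᴸ = foldr _+_ 0#

  sumᴸ-filter : ∀ {A : Set} {P : A → Set} (P? : ∀ j → Dec (P j)) (h : A → Carrier) {n} (g : Fin n → A) →
                sumᴸ (map h (filter P? (List.tabulate g))) ≈ sum (λ j → when (P? (g j)) (h (g j)))
  sumᴸ-filter P? h {zero}  g = ≈refl
  sumᴸ-filter P? h {suc n} g with P? (g zero)
  ... | yes _ = ∙-congˡ (sumᴸ-filter P? h (g ∘ suc))
  ... | no  _ = trans (sumᴸ-filter P? h (g ∘ suc)) (sym (identityˡ _))

  -- Turns sums along a list of takers into indicator sums. In the induction the predicate shrinks
  -- with the list: the tail enumerates the `j` with `P j` and `j ≢ v`.
  sumᴸ-unique : ∀ {n} {P : Fin n → Set} (P? : ∀ j → Dec (P j)) (h : Fin n → Carrier) {xs} → Unique xs →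
                (∀ v → v ∈ xs → P v) → (∀ v → P v → v ∈ xs) →
                sumᴸ (map h xs) ≈ sum (λ j → when (P? j) (h j))
  sumᴸ-unique P? h {[]} [] _ from = sym (sum-0 λ j → when-no (P? j) λ p → ¬Any[] (from j p))
  sumᴸ-unique {n} {P} P? h {v ∷ xs} (v∉ ∷ u) to from = sym (begin
    sum (λ j → when (P? j) (h j))
      ≈⟨ sum-update v (λ j j≢v → when-cong (P? j) (Q? j) (λ p → p , j≢v) proj₁ (λ _ → ≈refl))
           (trans (when-yes (P? v) (to v (here refl)))
             (sym (trans (∙-congˡ (when-no (Q? v) λ q → proj₂ q refl)) (identityʳ _)))) ⟩
    h v + sum (λ j → when (Q? j) (h j))
      ≈⟨ ∙-congˡ (sumᴸ-unique Q? h u (λ w w∈ → to w (there w∈) , λ w≡v → All.lookup v∉ w∈ (≡.sym w≡v))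
                   (λ w q → strip (from w (proj₁ q)) (proj₂ q))) ⟨
    h v + sumᴸ (map h xs) ∎)
    where
    open import Relation.Nullary using (_×-dec_; ¬?)
    open import Data.Fin.Properties using (_≟_)
    Q? : ∀ j → Dec (P j × j ≢ v)
    Q? j = P? j ×-dec ¬? (j ≟ v)
    strip : ∀ {w} → w ∈ v ∷ xs → w ≢ v → w ∈ xs
    strip (here w≡v)  w≢v = ⊥-elim (w≢v w≡v)
    strip (there w∈) _   = w∈

-- Depths, subtrees and the numbers of pieces

module TreeProperties {n : ℕ} (T : RootedTree n) where
  open RootedTree T
  open import Data.Nat.Base using (_≤_; _<_)

  -- `depth` is read off whichever path the tree supplies. There is no choice: `parent` is a
  -- function, and the root, where a path may stop, has no parent.
  path-unique : ∀ {v k l} → PathToRoot root parent v k → PathToRoot root parent v l → k ≡ l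
  path-unique here here = refl
  path-unique here (up p _) with () ← ≡.trans (≡.sym p) parent-root
  path-unique (up p _) here with () ← ≡.trans (≡.sym p) parent-root
  path-unique (up p π) (up q ρ) with refl ← ≡.trans (≡.sym p) q = ≡.cong suc (path-unique π ρ)

  depth-root : depth root ≡ 0
  depth-root = path-unique (proj₂ (path root)) here

  depth-parent : ∀ {p v} → p ParentOf v → depth v ≡ suc (depth p)
  depth-parent {p} {v} pv = path-unique (proj₂ (path v)) (up pv (proj₂ (path p)))

  ancestor-step : ∀ {u p w} → p ParentOf w → u AncestorOf w → p ≡ u ⊎ u AncestorOf p
  ancestor-step pw [ uw ] = inj₁ (Maybe.just-injective (≡.trans (≡.sym pw) uw))
  ancestor-step pw (us ∷ sw) with ancestor-step pw sw
  ... | inj₁ refl = inj₂ [ us ]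
  ... | inj₂ sp   = inj₂ (us ∷ sp)

  ancestor-depth : ∀ {u w} → u AncestorOf w → depth u < depth w
  ancestor-depth [ uw ]    = ℕₚ.≤-reflexive (≡.sym (depth-parent uw))
  ancestor-depth (us ∷ sw) = ℕₚ.<-trans (ℕₚ.≤-reflexive (≡.sym (depth-parent us))) (ancestor-depth sw)

  ancestor-irrefl : ∀ {u} → ¬ (u AncestorOf u)
  ancestor-irrefl uu = ℕₚ.<-irrefl refl (ancestor-depth uu)

  infix 4 _≼_

  -- Written with the same disjuncts as the predicate in `subtreeSize`, so that the two agree
  -- definitionally.
  _≼_ : Fin n → Fin n → Set
  v ≼ w = w ≡ v ⊎ v AncestorOf w

  ≼-ancestor-trans : ∀ {u v w} → u ≼ v → v AncestorOf w → u AncestorOf w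
  ≼-ancestor-trans (inj₁ refl) vw = vw
  ≼-ancestor-trans (inj₂ uv)   vw = uv Plus.++ vw

  ancestor-≼-trans : ∀ {u v w} → u AncestorOf v → v ≼ w → u AncestorOf w
  ancestor-≼-trans uv (inj₁ refl) = uv
  ancestor-≼-trans uv (inj₂ vw)   = uv Plus.++ vw

  ≼-parent : ∀ {u p w} → p ParentOf w → u ≼ p → u AncestorOf w
  ≼-parent pw u≼p = ≼-ancestor-trans u≼p [ pw ]

  root-no-ancestor : ∀ {u} → ¬ (u AncestorOf root)
  root-no-ancestor {u} ur with () ← ≡.subst (depth u <_) depth-root (ancestor-depth ur)

  -- All ancestors of `w` lie on its path to the root; going up this path, whichever of `u` and `v`
  -- is met first is the lower one.
  ancestors-comparable : ∀ {u v w} → u AncestorOf w → v AncestorOf w → v ≼ u ⊎ u AncestorOf v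
  ancestors-comparable {w = w} = go (proj₂ (path w))
    where
    go : ∀ {u v w k} → PathToRoot root parent w k → u AncestorOf w → v AncestorOf w → v ≼ u ⊎ u AncestorOf v
    go here uw _ = ⊥-elim (root-no-ancestor uw)
    go (up p π) uw vw with ancestor-step p uw | ancestor-step p vw
    ... | inj₁ refl | vp        = inj₁ vp
    ... | inj₂ up′  | inj₁ refl = inj₂ up′
    ... | inj₂ up′  | inj₂ vp   = go π up′ vp

  depth≤treeDepth : ∀ v → depth v ≤ treeDepth
  depth≤treeDepth v = All.lookup (Extrema.xs≤max 0 (map depth (allFin n))) (∈-map⁺ depth (∈-allFin v))

module PieceCounts (lem : ExcludedMiddle 0ℓ) (𝓡 : CompleteOrderedField) {n : ℕ} (T : RootedTree n)
                   (D : Fin n → CakeCutting.Density lem 𝓡) where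
  open RootedTree T
  open TreeProperties T
  open CakeCutting lem 𝓡 using (select; module AlgDescendantGraph)
  open AlgDescendantGraph T D using (subtreeSize; f)
  open import Data.Nat.Base using (_≤_; _<_; _+_; _*_; _/_)
  open IndicatorSum ℕₚ.+-0-commutativeMonoid
  open import Algebra.Properties.Semiring.Sum ℕₚ.+-*-semiring

  infix 4 _⋖?_ _≼?_

  _⋖?_ : ∀ u w → Dec (u AncestorOf w)
  u ⋖? w = lem

  _≼?_ : ∀ u w → Dec (u ≼ w)
  u ≼? w = lem

  when-* : {P : Set} (P? : Dec P) (a b : ℕ) → when P? (a * b) ≡ when P? a * b
  when-* (yes _) a b = refl
  when-* (no _)  a b = refl

  sum-when-const : {P : Fin n → Set} (P? : ∀ j → Dec (P j)) (c : ℕ) →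
                   sum (λ j → when (P? j) c) ≡ sum (λ j → when (P? j) 1) * c
  sum-when-const P? c = begin
    sum (λ j → when (P? j) c)       ≡⟨ sum-cong-≗ (λ j → ≡.trans (≡.cong (when (P? j)) (≡.sym (ℕₚ.*-identityˡ c)))
                                                            (when-* (P? j) 1 c)) ⟩
    sum (λ j → when (P? j) 1 * c)   ≡⟨ *-distribʳ-sum c (λ j → when (P? j) 1) ⟨
    sum (λ j → when (P? j) 1) * c   ∎
    where open ≡-Reasoning

  length-sum : {A : Set} (xs : List A) → length xs ≡ sumᴸ (map (λ _ → 1) xs)
  length-sum []       = refl
  length-sum (_ ∷ xs) = ≡.cong suc (length-sum xs)

  length-select : (P : Fin n → Set) → length (select P) ≡ sum (λ j → when (lem {P j}) 1)
  length-select P = ≡.trans (length-sum (select P)) (sumᴸ-filter (λ j → lem {P j}) (λ _ → 1) (λ j → j))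

  sum-mono : ∀ {m} {x y : Vector ℕ m} → (∀ j → x j ≤ y j) → sum x ≤ sum y
  sum-mono {zero}  x≤y = ℕ.z≤n
  sum-mono {suc m} x≤y = ℕₚ.+-mono-≤ (x≤y zero) (sum-mono (x≤y ∘ suc))

  sum-one : ∀ m → sum {m} (λ _ → 1) ≡ m
  sum-one zero    = refl
  sum-one (suc m) = ≡.cong suc (sum-one m)

  sum-≼ : ∀ w (x : Fin n → ℕ) → sum (λ v → when (v ≼? w) (x v)) ≡ x w + sum (λ v → when (v ⋖? w) (x v))
  sum-≼ w x = sum-update w
    (λ v v≢w → when-cong (v ≼? w) (v ⋖? w) (λ { (inj₁ w≡v) → ⊥-elim (v≢w (≡.sym w≡v)) ; (inj₂ vw) → vw }) inj₂ (λ _ → refl))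
    (≡.trans (when-yes (w ≼? w) (inj₁ refl))
             (≡.sym (≡.trans (≡.cong (x w +_) (when-no (w ⋖? w) ancestor-irrefl)) (ℕₚ.+-identityʳ _))))

  ancestorCount : ∀ w → sum (λ v → when (v ⋖? w) 1) ≡ depth w
  ancestorCount w = go (proj₂ (path w))
    where
    open ≡-Reasoning
    go : ∀ {w k} → PathToRoot root parent w k → sum (λ v → when (v ⋖? w) 1) ≡ k
    go here = sum-0 λ v → when-no (v ⋖? root) root-no-ancestor
    go {w} (up {p = p} {k} pw π) = begin
      sum (λ v → when (v ⋖? w) 1)     ≡⟨ sum-cong-≗ (λ v → when-cong (v ⋖? w) (v ≼? p)
                                           (ancestor-step pw) (≼-parent pw) λ _ → refl) ⟩
      sum (λ v → when (v ≼? p) 1)     ≡⟨ sum-≼ p (λ _ → 1) ⟩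
      suc (sum (λ v → when (v ⋖? p) 1)) ≡⟨ ≡.cong suc (go π) ⟩
      suc k                             ∎

  descendants : Fin n → ℕ
  descendants v = sum (λ w → when (v ⋖? w) 1)

  sum-subtree : ∀ v (x : Fin n → ℕ) → sum (λ w → when (v ≼? w) (x w)) ≡ x v + sum (λ w → when (v ⋖? w) (x w))
  sum-subtree v x = sum-update v
    (λ w w≢v → when-cong (v ≼? w) (v ⋖? w) (λ { (inj₁ w≡v) → ⊥-elim (w≢v w≡v) ; (inj₂ vw) → vw }) inj₂ (λ _ → refl))
    (≡.trans (when-yes (v ≼? v) (inj₁ refl))
             (≡.sym (≡.trans (≡.cong (x v +_) (when-no (v ⋖? v) ancestor-irrefl)) (ℕₚ.+-identityʳ _))))

  subtreeSize-sum : ∀ v → subtreeSize v ≡ sum (λ w → when (v ≼? w) 1)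
  subtreeSize-sum v = length-select (λ w → w ≡ v ⊎ v AncestorOf w)

  subtreeSize-suc : ∀ v → subtreeSize v ≡ suc (descendants v)
  subtreeSize-suc v = ≡.trans (subtreeSize-sum v) (sum-subtree v (λ _ → 1))

  -- The proper ancestors of `v` and the subtree of `v` are disjoint sets of vertices. This is what
  -- bounds one slicing by `n * treeDepth !` cuts.
  depth+subtreeSize≤n : ∀ v → depth v + subtreeSize v ≤ n
  depth+subtreeSize≤n v = begin
    depth v + subtreeSize v
      ≡⟨ ≡.cong₂ _+_ (≡.sym (ancestorCount v)) (subtreeSize-sum v) ⟩
    sum (λ j → when (j ⋖? v) 1) + sum (λ j → when (v ≼? j) 1)
      ≡⟨ ∑-distrib-+ (λ j → when (j ⋖? v) 1) (λ j → when (v ≼? j) 1) ⟨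
    sum (λ j → when (j ⋖? v) 1 + when (v ≼? j) 1)
      ≤⟨ sum-mono (λ j → disjoint j (j ⋖? v) (v ≼? j)) ⟩
    sum {n} (λ _ → 1)
      ≡⟨ sum-one n ⟩
    n ∎
    where
    open ℕₚ.≤-Reasoning
    disjoint : ∀ j (P? : Dec (j AncestorOf v)) (Q? : Dec (v ≼ j)) → when P? 1 + when Q? 1 ≤ 1
    disjoint j (yes jv) (yes vj) = ⊥-elim (ancestor-irrefl (ancestor-≼-trans jv vj))
    disjoint j (yes _)  (no _)   = ℕₚ.≤-refl
    disjoint j (no _)   (yes _)  = ℕₚ.≤-refl
    disjoint j (no _)   (no _)   = ℕ.z≤n

  -- That is, Σ (q(d(v)) − q(d(v) + 1)) over u < v ≤ w is q(d(u) + 1) − q(d(w) + 1).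
  telescope : (q : ℕ → ℕ) → ∀ {u w} → u ≼ w → let between? = λ v → lem {u AncestorOf v × v ≼ w} in
              sum (λ v → when (between? v) (q (depth v))) + q (suc (depth w)) ≡
              sum (λ v → when (between? v) (q (suc (depth v)))) + q (suc (depth u))
  telescope q {u} {w} = go (proj₂ (path w))
    where
    S : (ℕ → ℕ) → Fin n → ℕ
    S r w = sum (λ v → when (lem {u AncestorOf v × v ≼ w}) (r (depth v)))

    S-empty : ∀ r → S r u ≡ 0
    S-empty r = sum-0 {n} λ v → when-no (lem {u AncestorOf v × v ≼ u}) λ (uv , vu) → ancestor-irrefl (ancestor-≼-trans uv vu)

    S-parent : ∀ r {p w} → p ParentOf w → u AncestorOf w → S r w ≡ r (depth w) + S r p
    S-parent r {p} {w} pw uw = sum-update w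
      (λ v v≢w → when-cong lem lem
        (λ { (uv , inj₁ w≡v) → ⊥-elim (v≢w (≡.sym w≡v)) ; (uv , inj₂ vw) → uv , ancestor-step pw vw })
        (λ (uv , vp) → uv , inj₂ (≼-parent pw vp)) (λ _ → refl))
      (≡.trans (when-yes lem (uw , inj₁ refl))
        (≡.sym (≡.trans (≡.cong (r (depth w) +_)
                  (when-no lem λ (_ , wp) → ancestor-irrefl (≼-parent pw wp))) (ℕₚ.+-identityʳ _))))

    go : ∀ {w k} → PathToRoot root parent w k → u ≼ w →
         S q w + q (suc (depth w)) ≡ S (q ∘ suc) w + q (suc (depth u))
    go π (inj₁ refl) = ≡.cong (_+ q (suc (depth u))) (≡.trans (S-empty q) (≡.sym (S-empty (q ∘ suc))))
    go here (inj₂ uw) = ⊥-elim (root-no-ancestor uw)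
    go {w} (up {p = p} pw π) (inj₂ uw) = begin
      S q w + q (suc (depth w))                ≡⟨ ≡.cong (_+ q (suc (depth w))) (S-parent q pw uw) ⟩
      q (depth w) + S q p + q (suc (depth w))  ≡⟨ ≡.cong (λ e → q e + S q p + q (suc (depth w))) (depth-parent pw) ⟩
      q (suc (depth p)) + S q p + q (suc (depth w))
        ≡⟨ ≡.cong (_+ q (suc (depth w))) (≡.trans (ℕₚ.+-comm (q (suc (depth p))) (S q p)) (go π (ancestor-step pw uw))) ⟩
      S (q ∘ suc) p + q (suc (depth u)) + q (suc (depth w))
        ≡⟨ solve 3 (λ a b c → a :+ b :+ c := c :+ a :+ b) refl (S (q ∘ suc) p) (q (suc (depth u))) (q (suc (depth w))) ⟩
      q (suc (depth w)) + S (q ∘ suc) p + q (suc (depth u))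
        ≡⟨ ≡.cong (_+ q (suc (depth u))) (S-parent (q ∘ suc) pw uw) ⟨
      S (q ∘ suc) w + q (suc (depth u)) ∎
      where
      open ≡-Reasoning
      open ℕSolver.+-*-Solver

  -- After the exchange of sums, the vertices `w` paired with a fixed `v` are those of its subtree,
  -- as `u AncestorOf w` follows from `u AncestorOf v` and `v ≼ w`.
  doubleCount : ∀ u (x : Fin n → ℕ) →
    sum (λ w → when (u ⋖? w) (sum (λ v → when (lem {u AncestorOf v × v ≼ w}) (x v)))) ≡
    sum (λ v → when (u ⋖? v) (subtreeSize v * x v))
  doubleCount u x = begin
    sum (λ w → when (u ⋖? w) (sum (λ v → when lem (x v))))
      ≡⟨ sum-cong-≗ (λ w → when-sum (u ⋖? w) (λ v → when lem (x v))) ⟩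
    sum (λ w → sum (λ v → when (u ⋖? w) (when lem (x v))))
      ≡⟨ ∑-comm (λ w v → when (u ⋖? w) (when lem (x v))) ⟩
    sum (λ v → sum (λ w → when (u ⋖? w) (when lem (x v))))
      ≡⟨ sum-cong-≗ (λ v → ≡.trans (sum-cong-≗ (λ w → exchange v w (u ⋖? w) lem (u ⋖? v) (v ≼? w)))
                                  (≡.sym (when-sum (u ⋖? v) (λ w → when (v ≼? w) (x v))))) ⟩
    sum (λ v → when (u ⋖? v) (sum (λ w → when (v ≼? w) (x v))))
      ≡⟨ sum-cong-≗ (λ v → ≡.cong (when (u ⋖? v)) (≡.trans (sum-when-const (λ w → v ≼? w) (x v))
                                   (≡.cong (_* x v) (≡.sym (subtreeSize-sum v))))) ⟩
    sum (λ v → when (u ⋖? v) (subtreeSize v * x v)) ∎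
    where
    open ≡-Reasoning
    exchange : ∀ v w (A? : Dec (u AncestorOf w)) (B? : Dec (u AncestorOf v × v ≼ w))
           (C? : Dec (u AncestorOf v)) (E? : Dec (v ≼ w)) →
           when A? (when B? (x v)) ≡ when C? (when E? (x v))
    exchange v w A? (yes (uv , vw)) C? E? =
      ≡.trans (when-yes A? (ancestor-≼-trans uv vw)) (≡.sym (≡.trans (when-yes C? uv) (when-yes E? vw)))
    exchange v w A? (no ¬b) (yes uv) (yes vw) = ⊥-elim (¬b (uv , vw))
    exchange v w A? (no ¬b) (yes uv) (no _)   = when-0 A? refl
    exchange v w A? (no ¬b) (no _)   E?       = when-0 A? refl

  deepest-subtreeSize : ∀ v → ¬ (depth v < treeDepth) → subtreeSize v ≡ 1
  deepest-subtreeSize v ¬< = ≡.trans (subtreeSize-suc v) (≡.cong suc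
    (sum-0 λ w → when-no (v ⋖? w) λ vw → ¬< (ℕₚ.<-≤-trans (ancestor-depth vw) (depth≤treeDepth w))))

  ∣-! : ∀ {j m} → 1 ≤ j → j ≤ m → j ∣ m !
  ∣-! {suc j} _ j≤m = ∣-trans (m∣m*n (j !)) (m≤n⇒m!∣n! j≤m)

  f-* : ∀ v → f v * suc (depth v) ≡ (depth v + subtreeSize v) * treeDepth !
  f-* v = m/n*n≡m (div (ℕₚ._<?_ (depth v) treeDepth))
    where
    div : Dec (depth v < treeDepth) → suc (depth v) ∣ (depth v + subtreeSize v) * treeDepth !
    div (yes d<) = ∣n⇒∣m*n (depth v + subtreeSize v) (∣-! (ℕ.s≤s ℕ.z≤n) d<)
    div (no ¬d<) = ∣m⇒∣m*n (treeDepth !) (divides 1 (begin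
      depth v + subtreeSize v ≡⟨ ≡.cong (depth v +_) (deepest-subtreeSize v ¬d<) ⟩
      depth v + 1             ≡⟨ ℕₚ.+-comm (depth v) 1 ⟩
      suc (depth v)           ≡⟨ ℕₚ.*-identityˡ _ ⟨
      1 * suc (depth v)       ∎))
      where open ≡-Reasoning

  f-positive : ∀ v → 1 ≤ f v
  f-positive v = ℕₚ.n≢0⇒n>0 λ f≡0 →
    ℕₚ.<⇒≢ (ℕₚ.*-mono-≤ (ℕₚ.≤-trans (ℕ.s≤s ℕ.z≤n) (≡.subst (1 ≤_) (≡.sym (ℕₚ.+-suc (depth v) (descendants v))) (ℕ.s≤s ℕ.z≤n)))
                          (ℕₚ.1≤n! treeDepth))
            (≡.trans (≡.cong (_* suc (depth v)) (≡.sym f≡0))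
              (≡.trans (f-* v) (≡.cong (λ s → (depth v + s) * treeDepth !) (subtreeSize-suc v))))

  f≤n*treeDepth! : ∀ v → f v ≤ n * treeDepth !
  f≤n*treeDepth! v = ℕₚ.≤-trans (m/n≤m _ (suc (depth v))) (ℕₚ.*-monoˡ-≤ (treeDepth !) (depth+subtreeSize≤n v))

  -- f v / depth v, with a junk value at the root.
  share : Fin n → ℕ
  share v = f v / suc (ℕ.pred (depth v))

  -- The factor `depth v` survives the division by `depth v + 1` in `f v`. Above the last level,
  -- `treeDepth !` is a multiple of `(depth v + 1) !`, and the division leaves `depth v !`. On the
  -- last level `v` is a leaf and `f v` is `treeDepth !`.
  share-* : ∀ v → 1 ≤ depth v → share v * depth v ≡ f v
  share-* v 1≤d = ≡.trans (≡.cong (share v *_) (≡.sym d≡)) (m/n*n≡m (≡.subst (_∣ f v) (≡.sym d≡) (div (ℕₚ._<?_ (depth v) treeDepth))))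
    where
    open ≡-Reasoning
    d≡ : suc (ℕ.pred (depth v)) ≡ depth v
    d≡ = ℕₚ.suc-pred (depth v) {{ℕ.>-nonZero 1≤d}}

    div : Dec (depth v < treeDepth) → depth v ∣ f v
    div (no ¬d<) = ≡.subst (depth v ∣_) (≡.sym f≡) (∣-! 1≤d (depth≤treeDepth v))
      where
      f≡ : f v ≡ treeDepth !
      f≡ = ℕₚ.*-cancelʳ-≡ _ _ (suc (depth v)) (begin
        f v * suc (depth v)                      ≡⟨ f-* v ⟩
        (depth v + subtreeSize v) * treeDepth !  ≡⟨ ≡.cong (λ s → (depth v + s) * treeDepth !) (deepest-subtreeSize v ¬d<) ⟩
        (depth v + 1) * treeDepth !              ≡⟨ ≡.cong (_* treeDepth !) (ℕₚ.+-comm (depth v) 1) ⟩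
        suc (depth v) * treeDepth !              ≡⟨ ℕₚ.*-comm (suc (depth v)) _ ⟩
        treeDepth ! * suc (depth v)              ∎)
    div (yes d<) with m≤n⇒m!∣n! d<
    ... | divides c eq = ≡.subst (depth v ∣_) (≡.sym f≡) (∣n⇒∣m*n ((depth v + subtreeSize v) * c) (∣-! 1≤d ℕₚ.≤-refl))
      where
      f≡ : f v ≡ (depth v + subtreeSize v) * c * depth v !
      f≡ = ℕₚ.*-cancelʳ-≡ _ _ (suc (depth v)) (begin
        f v * suc (depth v)                      ≡⟨ f-* v ⟩
        (depth v + subtreeSize v) * treeDepth !  ≡⟨ ≡.cong ((depth v + subtreeSize v) *_) eq ⟩
        (depth v + subtreeSize v) * (c * (suc (depth v) * depth v !))
          ≡⟨ solve 4 (λ a b e g → a :* (b :* (e :* g)) := a :* b :* g :* e) refl (depth v + subtreeSize v) c (suc (depth v)) (depth v !) ⟩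
        (depth v + subtreeSize v) * c * depth v ! * suc (depth v) ∎)
        where open ℕSolver.+-*-Solver

  -- (d + 1)! is divisible by depth v + 1 even for a deepest leaf v, unlike d!.
  private
    M : ℕ
    M = suc treeDepth !

    q : ℕ → ℕ
    q zero    = 0
    q (suc j) = M / suc j

    q-* : ∀ {j} → 1 ≤ j → j ≤ suc treeDepth → q j * j ≡ M
    q-* {suc j} 1≤j j≤ = m/n*n≡m (∣-! 1≤j j≤)

    q-depth : ∀ v → q (suc (depth v)) * suc (depth v) ≡ M
    q-depth v = q-* (ℕ.s≤s ℕ.z≤n) (ℕ.s≤s (depth≤treeDepth v))

  -- Partial fractions: (δ + s) / (δ (δ + 1)) = 1 / (δ + 1) + s (1/δ - 1/(δ + 1)), multiplied by (d
  -- + 1)!, and with the negative term moved to the left to stay in `ℕ`.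
  share-q : ∀ v → 1 ≤ depth v →
            suc treeDepth * share v + subtreeSize v * q (suc (depth v)) ≡ q (suc (depth v)) + subtreeSize v * q (depth v)
  share-q v 1≤d = ℕₚ.*-cancelʳ-≡ _ _ (δ * suc δ) {{ℕ.>-nonZero (ℕₚ.*-mono-≤ 1≤d (ℕ.s≤s (ℕ.z≤n {δ})))}} (begin
    (suc treeDepth * k + s * q′) * (δ * suc δ)
      ≡⟨ solve 5 (λ D k s q′ δ → (D :* k :+ s :* q′) :* (δ :* (con 1 :+ δ)) :=
                  D :* ((k :* δ) :* (con 1 :+ δ)) :+ s :* δ :* (q′ :* (con 1 :+ δ))) refl (suc treeDepth) k s q′ δ ⟩
    suc treeDepth * ((k * δ) * suc δ) + s * δ * (q′ * suc δ)
      ≡⟨ ≡.cong₂ (λ a b → suc treeDepth * a + s * δ * b)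
                (≡.trans (≡.cong (_* suc δ) (share-* v 1≤d)) (f-* v)) (q-depth v) ⟩
    suc treeDepth * ((δ + s) * treeDepth !) + s * δ * M
      ≡⟨ solve 4 (λ D N s δ → D :* ((δ :+ s) :* N) :+ s :* δ :* (D :* N) :=
                   δ :* (D :* N) :+ s :* (con 1 :+ δ) :* (D :* N)) refl (suc treeDepth) (treeDepth !) s δ ⟩
    δ * M + s * suc δ * M
      ≡⟨ ≡.cong₂ (λ a b → δ * a + s * suc δ * b) (q-depth v) (q-* 1≤d (ℕₚ.m≤n⇒m≤1+n (depth≤treeDepth v))) ⟨
    δ * (q′ * suc δ) + s * suc δ * (q δ * δ)
      ≡⟨ solve 4 (λ s q′ r δ → δ :* (q′ :* (con 1 :+ δ)) :+ s :* (con 1 :+ δ) :* (r :* δ) :=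
                   (q′ :+ s :* r) :* (δ :* (con 1 :+ δ))) refl s q′ (q δ) δ ⟩
    (q′ + s * q δ) * (δ * suc δ) ∎)
    where
    open ≡-Reasoning
    open ℕSolver.+-*-Solver
    δ = depth v
    s = subtreeSize v
    k = share v
    q′ = q (suc (depth v))

  -- By `share-q` the left side is a sum of `q′ v` and of differences `q (depth v) − q′ v` weighted
  -- by subtree sizes. Double counting turns the weighted sum into one telescoping sum for each
  -- descendant `w` of `u`. The subtracted terms are added to both sides and cancelled at the end.
  descendants-share : ∀ u → suc treeDepth * sum (λ v → when (u ⋖? v) (share v)) ≡ descendants u * q (suc (depth u))
  descendants-share u = ℕₚ.+-cancelʳ-≡ (Σᵤ λ v → subtreeSize v * q′ v) _ _ (begin
    d⁺ * Σᵤ share + Σᵤ (λ v → subtreeSize v * q′ v)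
      ≡⟨ ≡.cong (_+ Σᵤ (λ v → subtreeSize v * q′ v)) (≡.trans (*-distribˡ-sum d⁺ (λ v → when (u ⋖? v) (share v)))
           (sum-cong-≗ λ v → when-*ˡ (u ⋖? v) (share v))) ⟩
    Σᵤ (λ v → d⁺ * share v) + Σᵤ (λ v → subtreeSize v * q′ v)
      ≡⟨ Σᵤ-+ (λ v → d⁺ * share v) (λ v → subtreeSize v * q′ v) ⟨
    Σᵤ (λ v → d⁺ * share v + subtreeSize v * q′ v)
      ≡⟨ Σᵤ-cong (λ v uv → share-q v (ℕₚ.≤-trans (ℕ.s≤s ℕ.z≤n) (ancestor-depth uv))) ⟩
    Σᵤ (λ v → q′ v + subtreeSize v * q (depth v))
      ≡⟨ Σᵤ-cong (λ v uv → ℕₚ.+-comm (q′ v) _) ⟩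
    Σᵤ (λ v → subtreeSize v * q (depth v) + q′ v)
      ≡⟨ Σᵤ-+ (λ v → subtreeSize v * q (depth v)) q′ ⟩
    Σᵤ (λ v → subtreeSize v * q (depth v)) + Σᵤ q′
      ≡⟨ ≡.cong (_+ Σᵤ q′) (doubleCount u (q ∘ depth)) ⟨
    Σᵤ (λ w → sum (between w (q ∘ depth))) + Σᵤ q′
      ≡⟨ Σᵤ-+ (λ w → sum (between w (q ∘ depth))) q′ ⟨
    Σᵤ (λ w → sum (between w (q ∘ depth)) + q′ w)
      -- The term `q′ w` left over from the partial fractions is exactly the lower end of the
      -- telescope from `u` down to `w`; only the upper end remains, which is the same for all `w`.
      ≡⟨ Σᵤ-cong (λ w uw → telescope q (inj₂ uw)) ⟩
    Σᵤ (λ w → sum (between w q′) + q (suc (depth u)))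
      ≡⟨ Σᵤ-+ (λ w → sum (between w q′)) (λ _ → q (suc (depth u))) ⟩
    Σᵤ (λ w → sum (between w q′)) + Σᵤ (λ _ → q (suc (depth u)))
      ≡⟨ ≡.cong₂ _+_ (doubleCount u q′) (sum-when-const (u ⋖?_) (q (suc (depth u)))) ⟩
    Σᵤ (λ v → subtreeSize v * q′ v) + descendants u * q (suc (depth u))
      ≡⟨ ℕₚ.+-comm (Σᵤ (λ v → subtreeSize v * q′ v)) _ ⟩
    descendants u * q (suc (depth u)) + Σᵤ (λ v → subtreeSize v * q′ v) ∎)
    where
    open ≡-Reasoning
    d⁺ = suc treeDepth
    q′ : Fin n → ℕ
    q′ v = q (suc (depth v))
    Σᵤ : (Fin n → ℕ) → ℕ
    Σᵤ x = sum (λ v → when (u ⋖? v) (x v))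
    between : Fin n → (Fin n → ℕ) → Fin n → ℕ
    between w x v = when (lem {u AncestorOf v × v ≼ w}) (x v)
    when-*ˡ : {P : Set} (P? : Dec P) (b : ℕ) → d⁺ * when P? b ≡ when P? (d⁺ * b)
    when-*ˡ (yes _) b = refl
    when-*ˡ (no _)  b = ℕₚ.*-zeroʳ d⁺
    Σᵤ-+ : ∀ x y → Σᵤ (λ v → x v + y v) ≡ Σᵤ x + Σᵤ y
    Σᵤ-+ x y = ≡.trans (sum-cong-≗ λ v → when-+ (u ⋖? v) (x v) (y v))
                       (∑-distrib-+ (λ v → when (u ⋖? v) (x v)) (λ v → when (u ⋖? v) (y v)))
    Σᵤ-cong : ∀ {x y} → (∀ v → u AncestorOf v → x v ≡ y v) → Σᵤ x ≡ Σᵤ y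
    Σᵤ-cong x≡y = sum-cong-≗ λ v → when-cong (u ⋖? v) (u ⋖? v) (λ p → p) (λ p → p) (x≡y v)

  -- In units of `r` = (d + 1)! / (δ + 1), the pieces kept contribute `suc δ` and each descendant
  -- contributes one on average, which makes `δ + subtreeSize u` units in all. That is (d + 1)
  -- `f u`.
  f-shares : ∀ u → treeDepth ! + sum (λ v → when (u ⋖? v) (share v)) ≡ f u
  f-shares u = ℕₚ.*-cancelˡ-≡ _ _ d⁺ (begin
    d⁺ * (N + S)                      ≡⟨ ℕₚ.*-distribˡ-+ d⁺ N S ⟩
    M + d⁺ * S                        ≡⟨ ≡.cong₂ _+_ (≡.sym (q-depth u)) (descendants-share u) ⟩
    r * suc δ + c * r                ≡⟨ solve 3 (λ r δ c → r :* (con 1 :+ δ) :+ c :* r := (δ :+ (con 1 :+ c)) :* r) refl r δ c ⟩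
    (δ + suc c) * r                  ≡⟨ ≡.cong (λ s → (δ + s) * r) (subtreeSize-suc u) ⟨
    (δ + subtreeSize u) * r          ≡⟨ ℕₚ.*-cancelʳ-≡ _ _ (suc δ) (begin
      (δ + subtreeSize u) * r * suc δ   ≡⟨ ℕₚ.*-assoc (δ + subtreeSize u) r (suc δ) ⟩
      (δ + subtreeSize u) * (r * suc δ) ≡⟨ ≡.cong ((δ + subtreeSize u) *_) (q-depth u) ⟩
      (δ + subtreeSize u) * (d⁺ * N)     ≡⟨ solve 3 (λ a d⁺ N → a :* (d⁺ :* N) := d⁺ :* (a :* N)) refl (δ + subtreeSize u) d⁺ N ⟩
      d⁺ * ((δ + subtreeSize u) * N)     ≡⟨ ≡.cong (d⁺ *_) (f-* u) ⟨
      d⁺ * (f u * suc δ)                 ≡⟨ ℕₚ.*-assoc d⁺ (f u) (suc δ) ⟨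
      d⁺ * f u * suc δ                   ∎) ⟩
    d⁺ * f u                          ∎)
    where
    open ≡-Reasoning
    open ℕSolver.+-*-Solver
    d⁺ = suc treeDepth
    N = treeDepth !
    S = sum (λ v → when (u ⋖? v) (share v))
    r = q (suc (depth u))
    δ = depth u
    c = descendants u

-- Ordered field arithmetic

-- The elements of an abstract ring have no computing equality test, which the ring solver needs to
-- cancel terms; integer coefficients have one.
module IntegerCoefficients (R : CommutativeRing 0ℓ 0ℓ) where
  open import Data.Integer.Base using (ℤ; +_; -[1+_])
  open CommutativeRing R renaming (Carrier to A; refl to ≈refl)
  open import Algebra.Properties.Ring ring using (-0#≈0#; -‿distribˡ-*)
  open import Algebra.Properties.Group +-group using (⁻¹-involutive)
  open import Algebra.Properties.AbelianGroup +-abelianGroup using (⁻¹-∙-comm)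
  open import Relation.Binary.Reasoning.Setoid setoid

  positive : ℕ → A
  positive zero    = 1#
  positive (suc n) = 1# + positive n

  -- `natural 1` is `1#` itself and not `1# + 0#`, so that `con ℤ.1ℤ` denotes the `1#` that occurs
  -- in the goals.
  natural : ℕ → A
  natural zero    = 0#
  natural (suc n) = positive n

  natural-suc : ∀ n → natural (suc n) ≈ 1# + natural n
  natural-suc zero    = sym (+-identityʳ 1#)
  natural-suc (suc n) = ≈refl

  natural-+ : ∀ m n → natural (m ℕ.+ n) ≈ natural m + natural n
  natural-+ zero    n = sym (+-identityˡ _)
  natural-+ (suc m) n = begin
    natural (suc (m ℕ.+ n))         ≈⟨ natural-suc (m ℕ.+ n) ⟩
    1# + natural (m ℕ.+ n)          ≈⟨ +-congˡ (natural-+ m n) ⟩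
    1# + (natural m + natural n)    ≈⟨ +-assoc _ _ _ ⟨
    (1# + natural m) + natural n    ≈⟨ +-congʳ (natural-suc m) ⟨
    natural (suc m) + natural n     ∎

  natural-* : ∀ m n → natural (m ℕ.* n) ≈ natural m * natural n
  natural-* zero    n = sym (zeroˡ _)
  natural-* (suc m) n = begin
    natural (n ℕ.+ m ℕ.* n)                  ≈⟨ natural-+ n (m ℕ.* n) ⟩
    natural n + natural (m ℕ.* n)            ≈⟨ +-cong (sym (*-identityˡ _)) (natural-* m n) ⟩
    1# * natural n + natural m * natural n   ≈⟨ distribʳ _ _ _ ⟨
    (1# + natural m) * natural n             ≈⟨ *-congʳ (natural-suc m) ⟨
    natural (suc m) * natural n              ∎

  integer : ℤ → A
  integer (+ n)    = natural n
  integer -[1+ n ] = - natural (suc n)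

  integer-neg : ∀ i → integer (ℤ.- i) ≈ - integer i
  integer-neg (+ zero)  = sym -0#≈0#
  integer-neg (+ suc n) = ≈refl
  integer-neg -[1+ n ]  = sym (⁻¹-involutive _)

  integer-⊖ : ∀ m n → integer (m ℤ.⊖ n) ≈ natural m + - natural n
  integer-⊖ m       zero    = sym (trans (+-congˡ -0#≈0#) (+-identityʳ _))
  integer-⊖ zero    (suc n) = sym (+-identityˡ _)
  integer-⊖ (suc m) (suc n) = begin
    integer (suc m ℤ.⊖ suc n)                      ≡⟨ ≡.cong integer (ℤₚ.[1+m]⊖[1+n]≡m⊖n m n) ⟩
    integer (m ℤ.⊖ n)                              ≈⟨ integer-⊖ m n ⟩
    natural m + - natural n                        ≈⟨ +-congʳ (+-identityʳ _) ⟨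
    (natural m + 0#) + - natural n                 ≈⟨ +-congʳ (+-congˡ (-‿inverseʳ 1#)) ⟨
    (natural m + (1# + - 1#)) + - natural n        ≈⟨ +-congʳ (+-assoc _ _ _) ⟨
    ((natural m + 1#) + - 1#) + - natural n        ≈⟨ +-assoc _ _ _ ⟩
    (natural m + 1#) + (- 1# + - natural n)        ≈⟨ +-cong (+-comm _ _) (⁻¹-∙-comm _ _) ⟩
    (1# + natural m) + - (1# + natural n)          ≈⟨ +-cong (natural-suc m) (-‿cong (natural-suc n)) ⟨
    natural (suc m) + - natural (suc n)            ∎

  integer-+ : ∀ i j → integer (i ℤ.+ j) ≈ integer i + integer j
  integer-+ (+ m)    (+ n)    = natural-+ m n
  integer-+ (+ m)    -[1+ n ] = integer-⊖ m (suc n)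
  integer-+ -[1+ m ] (+ n)    = trans (integer-⊖ n (suc m)) (+-comm _ _)
  integer-+ -[1+ m ] -[1+ n ] = begin
    - (1# + natural (suc (m ℕ.+ n)))             ≈⟨ -‿cong (+-congˡ (natural-suc (m ℕ.+ n))) ⟩
    - (1# + (1# + natural (m ℕ.+ n)))            ≈⟨ -‿cong (+-congˡ (+-congˡ (natural-+ m n))) ⟩
    - (1# + (1# + (natural m + natural n)))      ≈⟨ -‿cong (+-congˡ (+-assoc _ _ _)) ⟨
    - (1# + ((1# + natural m) + natural n))      ≈⟨ -‿cong (+-congˡ (+-comm _ _)) ⟩
    - (1# + (natural n + (1# + natural m)))      ≈⟨ -‿cong (+-assoc _ _ _) ⟨
    - ((1# + natural n) + (1# + natural m))      ≈⟨ -‿cong (+-comm _ _) ⟩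
    - ((1# + natural m) + (1# + natural n))      ≈⟨ -‿cong (+-cong (natural-suc m) (natural-suc n)) ⟨
    - (natural (suc m) + natural (suc n))        ≈⟨ ⁻¹-∙-comm _ _ ⟨
    - natural (suc m) + - natural (suc n)        ∎

  integer-*ˡ : ∀ m j → integer (+ m ℤ.* j) ≈ natural m * integer j
  integer-*ˡ m (+ n)    = begin
    integer (+ m ℤ.* + n) ≡⟨ ≡.cong integer (ℤₚ.pos-* m n) ⟨
    natural (m ℕ.* n)     ≈⟨ natural-* m n ⟩
    natural m * natural n ∎
  integer-*ˡ m -[1+ n ] = begin
    integer (+ m ℤ.* -[1+ n ])          ≡⟨ ≡.cong integer (ℤₚ.neg-distribʳ-* (+ m) (+ suc n)) ⟨
    integer (ℤ.- (+ m ℤ.* + suc n))     ≈⟨ integer-neg (+ m ℤ.* + suc n) ⟩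
    - integer (+ m ℤ.* + suc n)         ≈⟨ -‿cong (integer-*ˡ m (+ suc n)) ⟩
    - (natural m * natural (suc n))     ≈⟨ -‿distribʳ-* _ _ ⟩
    natural m * - natural (suc n)       ∎
    where open import Algebra.Properties.Ring ring using (-‿distribʳ-*)

  integer-* : ∀ i j → integer (i ℤ.* j) ≈ integer i * integer j
  integer-* (+ m)    j = integer-*ˡ m j
  integer-* -[1+ m ] j = begin
    integer (-[1+ m ] ℤ.* j)            ≡⟨ ≡.cong integer (ℤₚ.neg-distribˡ-* (+ suc m) j) ⟨
    integer (ℤ.- (+ suc m ℤ.* j))       ≈⟨ integer-neg (+ suc m ℤ.* j) ⟩
    - integer (+ suc m ℤ.* j)           ≈⟨ -‿cong (integer-*ˡ (suc m) j) ⟩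
    - (natural (suc m) * integer j)     ≈⟨ -‿distribˡ-* _ _ ⟩
    - natural (suc m) * integer j       ∎

  homomorphism : ℤ.+-*-rawRing -Raw-AlmostCommutative⟶ fromCommutativeRing R
  homomorphism = record
    { ⟦_⟧ = integer ; +-homo = integer-+ ; *-homo = integer-* ; -‿homo = integer-neg
    ; 0-homo = ≈refl ; 1-homo = ≈refl }

  coefficient≟ : ∀ i j → Maybe (integer i ≈ integer j)
  coefficient≟ i j with i ℤₚ.≟ j
  ... | yes i≡j = just (reflexive (≡.cong integer i≡j))
  ... | no  _   = nothing

  open RingSolver ℤ.+-*-rawRing (fromCommutativeRing R) homomorphism coefficient≟ public
    using (solve; _:=_; _:+_; _:*_; _:-_; :-_; con)

module RealProperties (lem : ExcludedMiddle 0ℓ) (𝓡 : CompleteOrderedField) where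
  open CompleteOrderedField 𝓡

  commutativeRing : CommutativeRing 0ℓ 0ℓ
  commutativeRing = record { isCommutativeRing = isCommutativeRing }

  totalOrder : TotalOrder 0ℓ 0ℓ 0ℓ
  totalOrder = record { isTotalOrder = isTotalOrder }

  open CommutativeRing commutativeRing public
    using (setoid; +-cong; +-congˡ; +-congʳ; *-cong; *-congˡ; *-congʳ; -‿cong; +-assoc; +-comm; +-identityˡ;
           +-identityʳ; *-identityˡ; *-identityʳ; zeroˡ; zeroʳ; *-comm; *-assoc; +-commutativeMonoid)
    renaming (refl to ≈refl; sym to ≈sym; trans to ≈trans; reflexive to ≈reflexive)
  open TotalOrder totalOrder public
    using (total; antisym; ≤-respˡ-≈; ≤-respʳ-≈)
    renaming (refl to ≤-refl; trans to ≤-trans; reflexive to ≤-reflexive)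
  open IntegerCoefficients commutativeRing public using (solve; _:=_; _:+_; _:*_; _:-_; :-_; con)
  open import Relation.Binary.Reasoning.Setoid setoid

  <⇒≱ : ∀ {x y} → x < y → ¬ (y ≤ x)
  <⇒≱ = NonStrictToStrict.<⇒≱ _≈_ _≤_ antisym

  ≰⇒> : ∀ {x y} → ¬ (x ≤ y) → y < x
  ≰⇒> = NonStrictToStrict.≰⇒> _≈_ _≤_ ≈sym ≤-reflexive total

  ≮⇒≥ : ∀ {x y} → ¬ (x < y) → y ≤ x
  ≮⇒≥ = NonStrictToStrict.≮⇒≥ _≈_ _≤_ ≈sym (λ _ _ → lem) ≤-reflexive total

  <-≤-trans : ∀ {x y z} → x < y → y ≤ z → x < z
  <-≤-trans = NonStrictToStrict.<-≤-trans _≈_ _≤_ ≈sym ≤-trans antisym ≤-respʳ-≈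

  ≤-<-trans : ∀ {x y z} → x ≤ y → y < z → x < z
  ≤-<-trans = NonStrictToStrict.≤-<-trans _≈_ _≤_ ≤-trans antisym ≤-respˡ-≈

  <-respʳ : ∀ {x y z} → y ≈ z → x < y → x < z
  <-respʳ y≈z x<y = <-≤-trans x<y (≤-reflexive y≈z)

  +-mono : ∀ {a b c d} → a ≤ b → c ≤ d → a + c ≤ b + d
  +-mono {a} {b} {c} {d} a≤b c≤d = ≤-trans (+-mono-≤ a b c a≤b)
    (≤-trans (≤-reflexive (+-comm b c)) (≤-trans (+-mono-≤ c d b c≤d) (≤-reflexive (+-comm d b))))

  -- The form in which the ring solver proves inequalities: a known inequality is transferred to any
  -- other pair with the same difference, and the equality of the differences is a ring identity.
  shift : ∀ {a b c d} → a ≤ b → d + - c ≈ b + - a → c ≤ d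
  shift {a} {b} {c} {d} a≤b eq = ≤-respˡ-≈ c≈ (≤-respʳ-≈ d≈ (+-mono-≤ a b (c + - a) a≤b))
    where
    c≈ : a + (c + - a) ≈ c
    c≈ = solve 2 (λ a c → a :+ (c :- a) := c) ≈refl a c
    d≈ : b + (c + - a) ≈ d
    d≈ = begin
      b + (c + - a)   ≈⟨ solve 3 (λ a b c → b :+ (c :- a) := (b :- a) :+ c) ≈refl a b c ⟩
      (b + - a) + c   ≈⟨ +-congʳ eq ⟨
      (d + - c) + c   ≈⟨ solve 2 (λ d c → (d :- c) :+ c := d) ≈refl d c ⟩
      d               ∎

  shift-< : ∀ {a b c d} → a < b → d + - c ≈ b + - a → c < d
  shift-< {a} {b} {c} {d} a<b eq = ≰⇒> λ d≤c → <⇒≱ a<b (shift d≤c (begin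
    a + - b      ≈⟨ solve 2 (λ a b → a :- b := :- (b :- a)) ≈refl a b ⟩
    - (b + - a)  ≈⟨ -‿cong eq ⟨
    - (d + - c)  ≈⟨ solve 2 (λ c d → :- (d :- c) := c :- d) ≈refl c d ⟩
    c + - d      ∎))

  difference-nonNeg : ∀ {a b} → a ≤ b → 0# ≤ b + - a
  difference-nonNeg {a} {b} a≤b = shift a≤b (solve 2 (λ a b → (b :- a) :- con ℤ.0ℤ := b :- a) ≈refl a b)

  difference-positive : ∀ {a b} → a < b → 0# < b + - a
  difference-positive {a} {b} a<b = shift-< a<b (solve 2 (λ a b → (b :- a) :- con ℤ.0ℤ := b :- a) ≈refl a b)

  +-nonNeg : ∀ {a b} → 0# ≤ a → 0# ≤ b → 0# ≤ a + b
  +-nonNeg 0≤a 0≤b = ≤-respˡ-≈ (+-identityˡ 0#) (+-mono 0≤a 0≤b)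

  +-positive : ∀ {a b} → 0# < a → 0# ≤ b → 0# < a + b
  +-positive {a} {b} 0<a 0≤b = <-≤-trans 0<a (shift 0≤b (solve 2 (λ a b → (a :+ b) :- a := b :- con ℤ.0ℤ) ≈refl a b))

  x≤x+y : ∀ {x y} → 0# ≤ y → x ≤ x + y
  x≤x+y {x} {y} 0≤y = shift 0≤y (solve 2 (λ x y → (x :+ y) :- x := y :- con ℤ.0ℤ) ≈refl x y)

  x<x+y : ∀ {x y} → 0# < y → x < x + y
  x<x+y {x} {y} 0<y = shift-< 0<y (solve 2 (λ x y → (x :+ y) :- x := y :- con ℤ.0ℤ) ≈refl x y)

  *-monoˡ : ∀ {x a b} → 0# ≤ x → a ≤ b → x * a ≤ x * b
  *-monoˡ {x} {a} {b} 0≤x a≤b = shift (*-nonNeg x (b + - a) 0≤x (difference-nonNeg a≤b))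
    (solve 3 (λ x a b → x :* b :- x :* a := x :* (b :- a) :- con ℤ.0ℤ) ≈refl x a b)

  *-monoʳ : ∀ {x a b} → 0# ≤ x → a ≤ b → a * x ≤ b * x
  *-monoʳ {x} {a} {b} 0≤x a≤b = ≤-respˡ-≈ (*-comm x a) (≤-respʳ-≈ (*-comm x b) (*-monoˡ 0≤x a≤b))

  *-inverseˡ : ∀ {x} → 0# < x → x ⁻¹ * x ≈ 1#
  *-inverseˡ {x} (_ , 0≉x) = ≈trans (*-comm _ _) (*-inverse x (0≉x ∘ ≈sym))

  ⁻¹-nonNeg : ∀ {x} → 0# < x → 0# ≤ x ⁻¹
  ⁻¹-nonNeg {x} 0<x with total 0# (x ⁻¹)
  ... | inj₁ 0≤ = 0≤
  ... | inj₂ ≤0 = ⊥-elim (<⇒≱ 0<1 (≤-respˡ-≈ (*-inverseˡ 0<x) (≤-respʳ-≈ (zeroˡ x) (*-monoʳ (proj₁ 0<x) ≤0))))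

  *-positive : ∀ {x y} → 0# < x → 0# < y → 0# < x * y
  *-positive {x} {y} 0<x 0<y = *-nonNeg x y (proj₁ 0<x) (proj₁ 0<y) , λ 0≈xy → proj₂ 0<y (begin
    0#              ≈⟨ zeroʳ _ ⟨
    x ⁻¹ * 0#       ≈⟨ *-congˡ 0≈xy ⟩
    x ⁻¹ * (x * y)  ≈⟨ *-assoc _ _ _ ⟨
    (x ⁻¹ * x) * y  ≈⟨ *-congʳ (*-inverseˡ 0<x) ⟩
    1# * y          ≈⟨ *-identityˡ y ⟩
    y               ∎)

  ⁻¹-positive : ∀ {x} → 0# < x → 0# < x ⁻¹
  ⁻¹-positive {x} 0<x = ⁻¹-nonNeg 0<x , λ 0≈ → proj₂ 0<1 (begin
    0#       ≈⟨ zeroˡ x ⟨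
    0# * x   ≈⟨ *-congʳ 0≈ ⟩
    x ⁻¹ * x ≈⟨ *-inverseˡ 0<x ⟩
    1#       ∎)

  *-cancelˡ-≤ : ∀ {x a b} → 0# < x → x * a ≤ x * b → a ≤ b
  *-cancelˡ-≤ {x} {a} {b} 0<x le = ≤-respˡ-≈ (cancel a) (≤-respʳ-≈ (cancel b) (*-monoˡ (⁻¹-nonNeg 0<x) le))
    where
    cancel : ∀ c → x ⁻¹ * (x * c) ≈ c
    cancel c = ≈trans (≈sym (*-assoc _ _ _)) (≈trans (*-congʳ (*-inverseˡ 0<x)) (*-identityˡ c))

  opaque
    half : ∀ {ε} → 0# < ε → ∃ λ η → 0# < η × η + η ≈ ε
    half {ε} 0<ε = (1# + 1#) ⁻¹ * ε , *-positive (⁻¹-positive 0<2) 0<ε , (begin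
      (1# + 1#) ⁻¹ * ε + (1# + 1#) ⁻¹ * ε
        ≈⟨ solve 2 (λ t e → t :* e :+ t :* e := (t :* (con ℤ.1ℤ :+ con ℤ.1ℤ)) :* e) ≈refl ((1# + 1#) ⁻¹) ε ⟩
      ((1# + 1#) ⁻¹ * (1# + 1#)) * ε ≈⟨ *-congʳ (*-inverseˡ 0<2) ⟩
      1# * ε                         ≈⟨ *-identityˡ ε ⟩
      ε                              ∎)
      where
      0<2 : 0# < 1# + 1#
      0<2 = +-positive 0<1 (proj₁ 0<1)

    quarter : ∀ {ε} → 0# < ε → ∃ λ η → 0# < η × (η + η) + (η + η) ≈ ε
    quarter 0<ε with half 0<ε
    ... | η , 0<η , 2η≈ε with half 0<η
    ... | ζ , 0<ζ , 2ζ≈η = ζ , 0<ζ , ≈trans (+-cong 2ζ≈η 2ζ≈η) 2η≈ε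

  ≤-epsilon : ∀ {a b} → (∀ ε → 0# < ε → a ≤ b + ε) → a ≤ b
  ≤-epsilon {a} {b} h = ≮⇒≥ λ b<a →
    let (η , 0<η , 2η≈) = half (difference-positive b<a) in
    <⇒≱ 0<η (shift (h η 0<η) (begin
      0# + - η                ≈⟨ solve 1 (λ η → con ℤ.0ℤ :- η := η :- (η :+ η)) ≈refl η ⟩
      η + - (η + η)           ≈⟨ +-congˡ (-‿cong 2η≈) ⟩
      η + - (a + - b)         ≈⟨ solve 3 (λ a b η → η :- (a :- b) := (b :+ η) :- a) ≈refl a b η ⟩
      (b + η) + - a           ∎))

  fromℕ-+ : ∀ m n → fromℕ (m ℕ.+ n) ≈ fromℕ m + fromℕ n
  fromℕ-+ zero    n = ≈sym (+-identityˡ _)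
  fromℕ-+ (suc m) n = ≈trans (+-congˡ (fromℕ-+ m n)) (≈sym (+-assoc _ _ _))

  fromℕ-* : ∀ m n → fromℕ (m ℕ.* n) ≈ fromℕ m * fromℕ n
  fromℕ-* zero    n = ≈sym (zeroˡ _)
  fromℕ-* (suc m) n = begin
    fromℕ (n ℕ.+ m ℕ.* n)         ≈⟨ fromℕ-+ n (m ℕ.* n) ⟩
    fromℕ n + fromℕ (m ℕ.* n)     ≈⟨ +-congˡ (fromℕ-* m n) ⟩
    fromℕ n + fromℕ m * fromℕ n   ≈⟨ solve 2 (λ m n → n :+ m :* n := (con ℤ.1ℤ :+ m) :* n) ≈refl (fromℕ m) (fromℕ n) ⟩
    (1# + fromℕ m) * fromℕ n      ∎

  fromℕ-nonNeg : ∀ n → 0# ≤ fromℕ n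
  fromℕ-nonNeg zero    = ≤-refl
  fromℕ-nonNeg (suc n) = +-nonNeg (proj₁ 0<1) (fromℕ-nonNeg n)

  fromℕ-positive : ∀ n → 0# < fromℕ (suc n)
  fromℕ-positive n = +-positive 0<1 (fromℕ-nonNeg n)

  fromℕ-mono : ∀ {m n} → m ℕ.≤ n → fromℕ m ≤ fromℕ n
  fromℕ-mono {n = n} ℕ.z≤n = fromℕ-nonNeg n
  fromℕ-mono (ℕ.s≤s m≤n) = +-mono ≤-refl (fromℕ-mono m≤n)

-- The gauge integral

module Integration (lem : ExcludedMiddle 0ℓ) (𝓡 : CompleteOrderedField) where
  open CakeCutting lem 𝓡
  open RealProperties lem 𝓡
  open import Algebra.Construct.NaturalChoice.Min totalOrder using (_⊓_; ⊓-cong; x⊓y≤x; x⊓y≤y)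
  open import Relation.Binary.Reasoning.Setoid setoid
  open Gauge

  ⊓-positive : ∀ {x y} → 0# < x → 0# < y → 0# < x ⊓ y
  ⊓-positive {x} {y} 0<x 0<y with total x y
  ... | inj₁ _ = 0<x
  ... | inj₂ _ = 0<y

  _⊓ᴳ_ : Gauge → Gauge → Gauge
  γ ⊓ᴳ γ′ = record
    { δ    = λ x → δ γ x ⊓ δ γ′ x
    ; cong = λ x≈y → ⊓-cong (cong γ x≈y) (cong γ′ x≈y)
    ; pos  = λ x → ⊓-positive (pos γ x) (pos γ′ x) }

  fine-weaken : ∀ {γ γ′ : Gauge} → (∀ x → δ γ x ≤ δ γ′ x) → ∀ {a b} (P : TaggedPartition a b) → Fine γ P → Fine γ′ P
  fine-weaken le (end _)          _              = tt
  fine-weaken le (cell c t _ _ P) (t< , c< , fine) =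
    <-≤-trans t< (+-mono ≤-refl (le t)) , <-≤-trans c< (+-mono ≤-refl (le t)) , fine-weaken le P fine

  fine-⊓ˡ : ∀ γ γ′ {a b} (P : TaggedPartition a b) → Fine (γ ⊓ᴳ γ′) P → Fine γ P
  fine-⊓ˡ γ γ′ = fine-weaken λ x → x⊓y≤x (δ γ x) (δ γ′ x)

  fine-⊓ʳ : ∀ γ γ′ {a b} (P : TaggedPartition a b) → Fine (γ ⊓ᴳ γ′) P → Fine γ′ P
  fine-⊓ʳ γ γ′ = fine-weaken λ x → x⊓y≤y (δ γ x) (δ γ′ x)

  partition-≤ : ∀ {a b} → TaggedPartition a b → a ≤ b
  partition-≤ (end a≈b)            = ≤-reflexive a≈b
  partition-≤ (cell c t a≤t t≤c P) = ≤-trans a≤t (≤-trans t≤c (partition-≤ P))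

  -- A partition may stop at a point that is only `≈` to its right endpoint, so joining has to move
  -- the left endpoint of the next one along an equality.
  castˡ : ∀ {a a′ b} → a ≈ a′ → TaggedPartition a′ b → TaggedPartition a b
  castˡ a≈a′ (end a′≈b)            = end (≈trans a≈a′ a′≈b)
  castˡ a≈a′ (cell c t a′≤t t≤c P) = cell c t (≤-respˡ-≈ (≈sym a≈a′) a′≤t) t≤c P

  castˡ-fine : ∀ {γ a a′ b} (a≈a′ : a ≈ a′) (P : TaggedPartition a′ b) → Fine γ P → Fine γ (castˡ a≈a′ P)
  castˡ-fine a≈a′ (end _)          _              = tt
  castˡ-fine a≈a′ (cell c t _ _ P) (t< , c< , fine) = <-respʳ (+-congʳ (≈sym a≈a′)) t< , c< , fine

  castˡ-sum : ∀ f {a a′ b} (a≈a′ : a ≈ a′) (P : TaggedPartition a′ b) → riemannSum f (castˡ a≈a′ P) ≈ riemannSum f P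
  castˡ-sum f a≈a′ (end _)          = ≈refl
  castˡ-sum f a≈a′ (cell c t _ _ P) = +-congʳ (*-congˡ (+-congˡ (-‿cong a≈a′)))

  join : ∀ {a c b} → TaggedPartition a c → TaggedPartition c b → TaggedPartition a b
  join (end a≈c)            Q = castˡ a≈c Q
  join (cell d t a≤t t≤d P) Q = cell d t a≤t t≤d (join P Q)

  join-fine : ∀ {γ a c b} (P : TaggedPartition a c) (Q : TaggedPartition c b) → Fine γ P → Fine γ Q → Fine γ (join P Q)
  join-fine (end a≈c)        Q _                fineQ = castˡ-fine a≈c Q fineQ
  join-fine (cell d t _ _ P) Q (t< , d< , fine) fineQ = t< , d< , join-fine P Q fine fineQ

  join-sum : ∀ f {a c b} (P : TaggedPartition a c) (Q : TaggedPartition c b) →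
             riemannSum f (join P Q) ≈ riemannSum f P + riemannSum f Q
  join-sum f (end a≈c)        Q = ≈trans (castˡ-sum f a≈c Q) (≈sym (+-identityˡ _))
  join-sum f (cell d t _ _ P) Q = ≈trans (+-congˡ (join-sum f P Q)) (≈sym (+-assoc _ _ _))

  Supremum : (ℝ → Set) → Set
  Supremum P = ∃ λ s → (∀ x → P x → x ≤ s) × (∀ b → (∀ x → P x → x ≤ b) → s ≤ b)

  supremum-approached : ∀ {P : ℝ → Set} {s η} → (∀ b → (∀ x → P x → x ≤ b) → s ≤ b) → 0# < η →
                        ∃ λ x → P x × s < x + η
  supremum-approached {P} {s} {η} least 0<η with lem {∃ λ x → P x × s < x + η}
  ... | yes found = found
  ... | no  absent  = ⊥-elim (<⇒≱ 0<η (shift (least (s + - η) upper)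
                      (solve 2 (λ s η → con ℤ.0ℤ :- η := (s :- η) :- s) ≈refl s η)))
    where
    upper : ∀ x → P x → x ≤ s + - η
    upper x px = shift (≮⇒≥ λ s< → absent (x , px , s<))
                       (solve 3 (λ x s η → (s :- η) :- x := s :- (x :+ η)) ≈refl x s η)


  opaque
    -- Cousin's lemma; without it `HasIntegral` could hold vacuously. Let `s` be the supremum of the
    -- points reached. Some reached point lies within the gauge of `s`, and one cell tagged at `s`
    -- leads from it to any point at or slightly beyond `s`. Either `b` is among these, or a point
    -- beyond `s` is reached, a contradiction.
    cousin : ∀ γ {a b} → a ≤ b → Σ (TaggedPartition a b) (Fine γ)
    cousin γ {a} {b} a≤b = finish (lem {b < s + δ γ s})
      where
      Reached : ℝ → Set
      Reached x = a ≤ x × x ≤ b × Σ (TaggedPartition a x) (Fine γ)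

      reached-a : Reached a
      reached-a = ≤-refl , a≤b , end ≈refl , tt

      sup : Supremum Reached
      sup = supremum Reached (a , reached-a) (b , λ x r → proj₁ (proj₂ r))
      s : ℝ
      s = proj₁ sup
      bound : ∀ x → Reached x → x ≤ s
      bound = proj₁ (proj₂ sup)
      a≤s : a ≤ s
      a≤s = bound a reached-a
      s≤b : s ≤ b
      s≤b = proj₂ (proj₂ sup) b λ x r → proj₁ (proj₂ r)

      extend : ∀ c → s ≤ c → c < s + δ γ s → Σ (TaggedPartition a c) (Fine γ)
      extend c s≤c c< with supremum-approached {Reached} (proj₂ (proj₂ sup)) (pos γ s)
      ... | x , rx@(_ , _ , P , fine) , s< =
        join P Q , join-fine P Q fine (s< , c< , tt)
        where
        Q : TaggedPartition x c
        Q = cell c s (bound x rx) s≤c (end ≈refl)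

      finish : Dec (b < s + δ γ s) → Σ (TaggedPartition a b) (Fine γ)
      finish (yes b<) = extend b s≤b b<
      finish (no ¬b<) with half (pos γ s)
      ... | η , 0<η , 2η≈ = ⊥-elim (<⇒≱ (x<x+y 0<η) (bound (s + η)
            (≤-trans a≤s s≤c , ≤-trans (proj₁ c<) (≮⇒≥ ¬b<) , extend (s + η) s≤c c<)))
        where
        s≤c : s ≤ s + η
        s≤c = x≤x+y (proj₁ 0<η)
        c< : s + η < s + δ γ s
        c< = shift-< 0<η (begin
          (s + δ γ s) + - (s + η)   ≈⟨ +-congʳ (+-congˡ 2η≈) ⟨
          (s + (η + η)) + - (s + η) ≈⟨ solve 2 (λ s η → (s :+ (η :+ η)) :- (s :+ η) := η :- con ℤ.0ℤ) ≈refl s η ⟩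
          η + - 0#                  ∎)

  -- Each half is chosen fine for its own gauge and for that of `K`, so one joined Riemann sum is
  -- close to `K` and, part by part, to `I` and `J`. There are three errors `η`; the fourth quarter
  -- of `ε` is filled with `0 ≤ η`.
  hasIntegral-additive : ∀ {f a b c I J K} → a ≤ c → c ≤ b → HasIntegral f a c I → HasIntegral f c b J →
                         HasIntegral f a b K → K ≈ I + J
  hasIntegral-additive {f} {a} {b} {c} {I} {J} {K} a≤c c≤b hI hJ hK =
    antisym (≤-epsilon λ ε 0<ε → proj₁ (close ε 0<ε)) (≤-epsilon λ ε 0<ε → proj₂ (close ε 0<ε))
    where
    close : ∀ ε → 0# < ε → K ≤ (I + J) + ε × I + J ≤ K + ε
    close ε 0<ε with quarter 0<ε
    ... | η , 0<η , 4η≈ with hI η 0<η | hJ η 0<η | hK η 0<η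
    ... | γ₁ , near₁ | γ₂ , near₂ | γ₃ , near₃
        with cousin (γ₁ ⊓ᴳ γ₃) a≤c | cousin (γ₂ ⊓ᴳ γ₃) c≤b
    ... | P , fineP | Q , fineQ
        with near₁ P (fine-⊓ˡ γ₁ γ₃ P fineP) | near₂ Q (fine-⊓ˡ γ₂ γ₃ Q fineQ)
           | near₃ (join P Q) (join-fine P Q (fine-⊓ʳ γ₁ γ₃ P fineP) (fine-⊓ʳ γ₂ γ₃ Q fineQ))
    ... | S₁≤ , I≤ | S₂≤ , J≤ | S≤ , K≤ =
      ≤-trans (≤-respʳ-≈ (+-congʳ (join-sum f P Q)) K≤)
        (≤-trans (shift (+-mono (+-mono S₁≤ S₂≤) (proj₁ 0<η))
          (solve 5 (λ s t i j η → (i :+ j :+ ((η :+ η) :+ (η :+ η))) :- (s :+ t :+ η) :=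
                                  (i :+ η :+ (j :+ η) :+ η) :- (s :+ t :+ con ℤ.0ℤ)) ≈refl
             (riemannSum f P) (riemannSum f Q) I J η))
          (≤-reflexive (+-congˡ 4η≈))) ,
      ≤-trans (shift (+-mono (+-mono I≤ J≤) (+-mono (≤-respˡ-≈ (join-sum f P Q) S≤) (proj₁ 0<η)))
          (solve 6 (λ s t i j k η → (k :+ ((η :+ η) :+ (η :+ η))) :- (i :+ j) :=
                                  ((s :+ η) :+ (t :+ η) :+ ((k :+ η) :+ η)) :- (i :+ j :+ ((s :+ t) :+ con ℤ.0ℤ))) ≈refl
             (riemannSum f P) (riemannSum f Q) I J K η))
          (≤-reflexive (+-congˡ 4η≈))

  -- The integral over [p , q] is the supremum of the numbers that are below all sufficiently fine Riemann sums.
  integrable-subinterval : ∀ {f a b p q} → a ≤ p → p ≤ q → q ≤ b → Integrable f a b → Integrable f p q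
  integrable-subinterval {f} {a} {b} {p} {q} a≤p p≤q q≤b (K , hK) = L , hasL
    where
    opaque
      -- Two partitions of `[p , q]` are completed by the same outer partitions `A` and `B`, so
      -- their sums differ as the completed sums do, and those are both near `K`.
      cauchy : ∀ ε → 0# < ε → Σ Gauge λ γ → (P P′ : TaggedPartition p q) → Fine γ P → Fine γ P′ →
               riemannSum f P ≤ riemannSum f P′ + ε
      cauchy ε 0<ε with half 0<ε
      ... | η , 0<η , 2η≈ with hK η 0<η
      ... | γ , near with cousin γ a≤p | cousin γ q≤b
      ... | A , fineA | B , fineB = γ , λ P P′ fine fine′ →
        shift (+-mono (≤-respˡ-≈ (whole-sum P) (proj₁ (near (complete P) (complete-fine P fine))))
                      (≤-respʳ-≈ (+-congʳ (whole-sum P′)) (proj₂ (near (complete P′) (complete-fine P′ fine′)))))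
          (begin
            (riemannSum f P′ + ε) + - riemannSum f P         ≈⟨ +-congʳ (+-congˡ 2η≈) ⟨
            (riemannSum f P′ + (η + η)) + - riemannSum f P
              ≈⟨ solve 6 (λ s s′ α β k η → (s′ :+ (η :+ η)) :- s :=
                     ((k :+ η) :+ ((α :+ (s′ :+ β)) :+ η)) :- ((α :+ (s :+ β)) :+ k)) ≈refl
                   (riemannSum f P) (riemannSum f P′) (riemannSum f A) (riemannSum f B) K η ⟩
            _ ∎)
        where
        complete : TaggedPartition p q → TaggedPartition a b
        complete P = join A (join P B)
        complete-fine : ∀ P → Fine γ P → Fine γ (complete P)
        complete-fine P fine = join-fine A (join P B) fineA (join-fine P B fine fineB)
        whole-sum : ∀ P → riemannSum f (complete P) ≈ riemannSum f A + (riemannSum f P + riemannSum f B)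
        whole-sum P = ≈trans (join-sum f A (join P B)) (+-congˡ (join-sum f P B))

    Below : ℝ → Set
    Below x = Σ Gauge λ γ → (P : TaggedPartition p q) → Fine γ P → x ≤ riemannSum f P

    below : ∀ ε 0<ε (P : TaggedPartition p q) → Fine (proj₁ (cauchy ε 0<ε)) P → Below (riemannSum f P + - ε)
    below ε 0<ε P fine = proj₁ (cauchy ε 0<ε) , λ P′ fine′ → shift (proj₂ (cauchy ε 0<ε) P P′ fine fine′)
      (solve 3 (λ s s′ ε → s′ :- (s :- ε) := (s′ :+ ε) :- s) ≈refl (riemannSum f P) (riemannSum f P′) ε)

    above : ∀ ε 0<ε (P : TaggedPartition p q) → Fine (proj₁ (cauchy ε 0<ε)) P → ∀ x → Below x → x ≤ riemannSum f P + ε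
    above ε 0<ε P fine x (γ , low) with cauchy ε 0<ε
    ... | γ′ , close with cousin (γ ⊓ᴳ γ′) p≤q
    ... | P′ , fine′ = ≤-trans (low P′ (fine-⊓ˡ γ γ′ P′ fine′)) (close P′ P (fine-⊓ʳ γ γ′ P′ fine′) fine)

    initial : Σ (TaggedPartition p q) (Fine (proj₁ (cauchy 1# 0<1)))
    initial = cousin (proj₁ (cauchy 1# 0<1)) p≤q

    sup = supremum Below (_ , below 1# 0<1 (proj₁ initial) (proj₂ initial)) (_ , above 1# 0<1 (proj₁ initial) (proj₂ initial))
    L = proj₁ sup

    hasL : HasIntegral f p q L
    hasL ε 0<ε = proj₁ (cauchy ε 0<ε) , λ P fine →
      shift (proj₁ (proj₂ sup) _ (below ε 0<ε P fine))
        (solve 3 (λ l s ε → (l :+ ε) :- s := l :- (s :- ε)) ≈refl L (riemannSum f P) ε) ,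
      proj₂ (proj₂ sup) _ (above ε 0<ε P fine)

  ∫-hasIntegral : ∀ {f a b} → Integrable f a b → HasIntegral f a b (∫ f a b)
  ∫-hasIntegral {f} {a} {b} int with lem {Integrable f a b}
  ... | yes (_ , hI) = hI
  ... | no  ¬int     = ⊥-elim (¬int int)

  -- The integral of a density as a function of its endpoints

  module DensityIntegral (D : Density) where
    open Density D hiding (cong)

    opaque
      -- A density is integrable on every subinterval of the cake, so the default value `0#` of `∫`
      -- never occurs there.
      hasIntegral : ∀ {a b} → 0# ≤ a → a ≤ b → b ≤ 1# → HasIntegral v a b (∫ v a b)
      hasIntegral 0≤a a≤b b≤1 = ∫-hasIntegral (integrable-subinterval 0≤a a≤b b≤1 integrable)

    ∫-additive : ∀ {a c b} → 0# ≤ a → a ≤ c → c ≤ b → b ≤ 1# → ∫ v a b ≈ ∫ v a c + ∫ v c b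
    ∫-additive 0≤a a≤c c≤b b≤1 = hasIntegral-additive a≤c c≤b
      (hasIntegral 0≤a a≤c (≤-trans c≤b b≤1)) (hasIntegral (≤-trans 0≤a a≤c) c≤b b≤1)
      (hasIntegral 0≤a (≤-trans a≤c c≤b) b≤1)

    riemannSum-nonNeg : ∀ {a b} → 0# ≤ a → b ≤ 1# → (P : TaggedPartition a b) → 0# ≤ riemannSum v P
    riemannSum-nonNeg 0≤a b≤1 (end _) = ≤-refl
    riemannSum-nonNeg 0≤a b≤1 (cell c t a≤t t≤c P) = +-nonNeg
      (*-nonNeg _ _ (nonNeg t (≤-trans 0≤a a≤t) (≤-trans t≤c (≤-trans (partition-≤ P) b≤1)))
                    (difference-nonNeg (≤-trans a≤t t≤c)))
      (riemannSum-nonNeg (≤-trans 0≤a (≤-trans a≤t t≤c)) b≤1 P)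

    ∫-nonNeg : ∀ {a b} → 0# ≤ a → a ≤ b → b ≤ 1# → 0# ≤ ∫ v a b
    ∫-nonNeg 0≤a a≤b b≤1 = ≤-epsilon λ ε 0<ε →
      let (γ , near) = hasIntegral 0≤a a≤b b≤1 ε 0<ε
          (P , fine) = cousin γ a≤b
      in ≤-trans (riemannSum-nonNeg 0≤a b≤1 P) (proj₁ (near P fine))

    ∫-point : ∀ {a} → 0# ≤ a → a ≤ 1# → ∫ v a a ≈ 0#
    ∫-point {a} 0≤a a≤1 = begin
      x            ≈⟨ solve 1 (λ x → x := (x :+ x) :- x) ≈refl x ⟩
      (x + x) + - x ≈⟨ +-congʳ (∫-additive 0≤a ≤-refl ≤-refl a≤1) ⟨
      x + - x      ≈⟨ solve 1 (λ x → x :- x := con ℤ.0ℤ) ≈refl x ⟩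
      0#           ∎
      where x = ∫ v a a

    -- Rather than moving an endpoint along `a ≈ b`, additivity is applied to `a ≤ b ≤ a`: the
    -- integrals from `a` to `b` and from `b` to `a` are non-negative and add up to that over a
    -- point.
    ∫-degenerate : ∀ {a b} → 0# ≤ a → a ≤ b → b ≤ a → b ≤ 1# → ∫ v a b ≤ 0#
    ∫-degenerate 0≤a a≤b b≤a b≤1 =
      ≤-trans (x≤x+y (∫-nonNeg (≤-trans 0≤a a≤b) b≤a (≤-trans a≤b b≤1)))
        (≤-reflexive (≈trans (≈sym (∫-additive 0≤a a≤b b≤a (≤-trans a≤b b≤1))) (∫-point 0≤a (≤-trans a≤b b≤1))))

    -- Compare the Riemann sum of a fine partition of [0 , 1] having a cell [p , q] with tag x to the
    -- integrals over [0 , p], [p , q] and [q , 1].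
    opaque
      ∫-small : ∀ {x ε} → 0# ≤ x → x ≤ 1# → 0# < ε →
                ∃ λ η → 0# < η × (∀ p q → 0# ≤ p → p ≤ x → x ≤ q → q ≤ 1# → q < p + η → ∫ v p q ≤ ε)
      ∫-small {x} {ε} 0≤x x≤1 0<ε with quarter 0<ε
      ... | e , 0<e , 4e≈ with hasIntegral ≤-refl (proj₁ 0<1) ≤-refl e 0<e
      ... | γ , near = η , ⊓-positive (pos γ x) (*-positive 0<e (⁻¹-positive 0<1+v)) , small
        where
        0≤v : 0# ≤ v x
        0≤v = nonNeg x 0≤x x≤1
        0<1+v : 0# < 1# + v x
        0<1+v = +-positive 0<1 0≤v
        -- The first bound makes `[p , q]` with tag `x` a fine cell, the second keeps its term of
        -- the Riemann sum below `e`. The summand `1#` allows the division where the density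
        -- vanishes.
        η : ℝ
        η = δ γ x ⊓ (e * (1# + v x) ⁻¹)

        small : ∀ p q → 0# ≤ p → p ≤ x → x ≤ q → q ≤ 1# → q < p + η → ∫ v p q ≤ ε
        small p q 0≤p p≤x x≤q q≤1 q<
          with hasIntegral ≤-refl 0≤p (≤-trans (≤-trans p≤x x≤q) q≤1) e 0<e
             | hasIntegral (≤-trans 0≤p (≤-trans p≤x x≤q)) q≤1 ≤-refl e 0<e
        ... | γ₁ , near₁ | γ₂ , near₂ with cousin (γ₁ ⊓ᴳ γ) 0≤p | cousin (γ₂ ⊓ᴳ γ) q≤1
        ... | P , fineP | Q , fineQ = ≤-trans (shift (+-mono (+-mono I≤ cell≤)
                 (+-mono (proj₁ (near₁ P (fine-⊓ˡ γ₁ γ P fineP))) (proj₁ (near₂ Q (fine-⊓ˡ γ₂ γ Q fineQ)))))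
               (begin
                 ((e + e) + (e + e)) + - m
                   ≈⟨ solve 7 (λ e a m b s r t → ((e :+ e) :+ (e :+ e)) :- m :=
                        (((s :+ (r :+ t)) :+ e) :+ e :+ ((a :+ e) :+ (b :+ e))) :-
                        ((a :+ (m :+ b)) :+ r :+ (s :+ t))) ≈refl e (∫ v 0# p) m (∫ v q 1#)
                        (riemannSum v P) (v x * (q + - p)) (riemannSum v Q) ⟩
                 _ ∎))
             (≤-reflexive 4e≈)
          where
          m : ℝ
          m = ∫ v p q
          p≤q : p ≤ q
          p≤q = ≤-trans p≤x x≤q
          q<p+δ : q < p + δ γ x
          q<p+δ = <-≤-trans q< (+-mono ≤-refl (x⊓y≤x (δ γ x) (e * (1# + v x) ⁻¹)))
          R : TaggedPartition p 1#
          R = cell q x p≤x x≤q Q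
          I≤ : ∫ v 0# p + (m + ∫ v q 1#) ≤ (riemannSum v P + (v x * (q + - p) + riemannSum v Q)) + e
          I≤ = ≤-respˡ-≈ (≈trans (∫-additive ≤-refl 0≤p (≤-trans p≤q q≤1) ≤-refl)
                                 (+-congˡ (∫-additive 0≤p p≤q q≤1 ≤-refl)))
                 (≤-respʳ-≈ (+-congʳ (join-sum v P R)) (proj₂ (near (join P R)
                   (join-fine P R (fine-⊓ʳ γ₁ γ P fineP)
                     (≤-<-trans x≤q q<p+δ , <-≤-trans q<p+δ (+-mono p≤x ≤-refl) , fine-⊓ʳ γ₂ γ Q fineQ)))))
          cell≤ : v x * (q + - p) ≤ e
          cell≤ = ≤-trans (*-monoˡ 0≤v q-p≤) (≤-trans (*-monoʳ (≤-trans 0≤q-p q-p≤) (shift (proj₁ 0<1)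
                    (solve 1 (λ v → (con ℤ.1ℤ :+ v) :- v := con ℤ.1ℤ :- con ℤ.0ℤ) ≈refl (v x)))) (≤-reflexive (begin
              (1# + v x) * (e * (1# + v x) ⁻¹) ≈⟨ solve 3 (λ w e i → w :* (e :* i) := e :* (i :* w)) ≈refl _ e _ ⟩
              e * ((1# + v x) ⁻¹ * (1# + v x)) ≈⟨ *-congˡ (*-inverseˡ 0<1+v) ⟩
              e * 1#                           ≈⟨ *-identityʳ e ⟩
              e                                ∎)))
            where
            0≤q-p : 0# ≤ q + - p
            0≤q-p = difference-nonNeg p≤q
            q-p≤ : q + - p ≤ e * (1# + v x) ⁻¹
            q-p≤ = shift (≤-trans (proj₁ q<) (+-mono (≤-refl {p}) (x⊓y≤y (δ γ x) (e * (1# + v x) ⁻¹))))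
                     (solve 3 (λ p q r → r :- (q :- p) := (p :+ r) :- q) ≈refl p q (e * (1# + v x) ⁻¹))

    -- `s` is the supremum of the points up to which the integral is at most `y`. By `∫-small` the
    -- integral changes little on short intervals on either side of `s`: points of `Low` to the left
    -- give `upper`, and a point `c` just to the right gives `lower`. If `b` is itself that close to
    -- `s`, then `c` is `b`.
    intermediateValue : ∀ {a b y} → 0# ≤ a → a ≤ b → b ≤ 1# → 0# ≤ y → y ≤ ∫ v a b →
                        ∃ λ c → a ≤ c × c ≤ b × ∫ v a c ≈ y
    intermediateValue {a} {b} {y} 0≤a a≤b b≤1 0≤y y≤ =
      s , a≤s , s≤b , antisym (≤-epsilon upper) (≤-epsilon lower)
      where
      Low : ℝ → Set
      Low x = a ≤ x × x ≤ b × ∫ v a x ≤ y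
      low-a : Low a
      low-a = ≤-refl , a≤b , ≤-respˡ-≈ (≈sym (∫-point 0≤a (≤-trans a≤b b≤1))) 0≤y
      sup : Supremum Low
      sup = supremum Low (a , low-a) (b , λ x l → proj₁ (proj₂ l))
      s = proj₁ sup
      bound = proj₁ (proj₂ sup)
      a≤s : a ≤ s
      a≤s = bound a low-a
      s≤b : s ≤ b
      s≤b = proj₂ (proj₂ sup) b λ x l → proj₁ (proj₂ l)
      0≤s = ≤-trans 0≤a a≤s
      s≤1 = ≤-trans s≤b b≤1

      upper : ∀ ε → 0# < ε → ∫ v a s ≤ y + ε
      upper ε 0<ε =
        let (η , 0<η , small) = ∫-small 0≤s s≤1 0<ε
            (x , lx@(a≤x , _ , ≤y) , s<) = supremum-approached {Low} (proj₂ (proj₂ sup)) 0<η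
        in ≤-respˡ-≈ (≈sym (∫-additive 0≤a a≤x (bound x lx) s≤1))
             (+-mono ≤y (small x s (≤-trans 0≤a a≤x) (bound x lx) ≤-refl s≤1 s<))

      above-s : ∀ c → s < c → c ≤ b → y ≤ ∫ v a c
      above-s c s<c c≤b = ≮⇒≥ λ <y → <⇒≱ s<c (bound c (≤-trans a≤s (proj₁ s<c) , c≤b , proj₁ <y))

      step : ∀ {η} → 0# < η → Dec (b < s + η) → ∃ λ c → s ≤ c × c ≤ b × c < s + η × y ≤ ∫ v a c
      step 0<η (yes b<) = b , s≤b , ≤-refl , b< , y≤
      step {η} 0<η (no ¬b<) = s + ζ , proj₁ s<c , c≤b , c< , above-s (s + ζ) s<c c≤b
        where
        ζ = proj₁ (half 0<η)
        s<c : s < s + ζ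
        s<c = x<x+y (proj₁ (proj₂ (half 0<η)))
        c< : s + ζ < s + η
        c< = <-respʳ (≈trans (+-assoc s ζ ζ) (+-congˡ (proj₂ (proj₂ (half 0<η))))) (x<x+y (proj₁ (proj₂ (half 0<η))))
        c≤b : s + ζ ≤ b
        c≤b = ≤-trans (proj₁ c<) (≮⇒≥ ¬b<)

      Small : ℝ → ℝ → Set
      Small ε η = ∀ p q → 0# ≤ p → p ≤ s → s ≤ q → q ≤ 1# → q < p + η → ∫ v p q ≤ ε

      beyond : ∀ {ε η} → Small ε η → (∃ λ c → s ≤ c × c ≤ b × c < s + η × y ≤ ∫ v a c) → y ≤ ∫ v a s + ε
      beyond small (c , s≤c , c≤b , c< , y≤c) = ≤-trans y≤c
        (≤-respˡ-≈ (≈sym (∫-additive 0≤a a≤s s≤c (≤-trans c≤b b≤1)))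
          (+-mono ≤-refl (small s c 0≤s ≤-refl s≤c (≤-trans c≤b b≤1) c<)))

      conclude : ∀ {ε} → (∃ λ η → 0# < η × Small ε η) → y ≤ ∫ v a s + ε
      conclude (η , 0<η , small) = beyond small (step 0<η lem)

      lower : ∀ ε → 0# < ε → y ≤ ∫ v a s + ε
      lower ε 0<ε = conclude (∫-small 0≤s s≤1 0<ε)

    -- A cut must lie in the interior of its interval. At either endpoint the integral would be 0 or
    -- everything, against the strict bounds on `y`.
    intermediateValue-strict : ∀ {a b y} → 0# ≤ a → a ≤ b → b ≤ 1# → 0# < y → y < ∫ v a b →
                               ∃ λ c → a < c × c < b × ∫ v a c ≈ y
    intermediateValue-strict {a} {b} {y} 0≤a a≤b b≤1 0<y y< = interior (intermediateValue 0≤a a≤b b≤1 (proj₁ 0<y) (proj₁ y<))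
      where
      interior : (∃ λ c → a ≤ c × c ≤ b × ∫ v a c ≈ y) → ∃ λ c → a < c × c < b × ∫ v a c ≈ y
      interior (c , a≤c , c≤b , eq) = c ,
        ≰⇒> (λ c≤a → <⇒≱ 0<y (≤-respˡ-≈ eq (∫-degenerate 0≤a a≤c c≤a (≤-trans c≤b b≤1)))) ,
        ≰⇒> (λ b≤c → <⇒≱ y< (≤-respˡ-≈ (≈sym (∫-additive 0≤a a≤c c≤b b≤1))
               (≤-respʳ-≈ (+-identityʳ _) (+-mono (≤-reflexive eq) (∫-degenerate (≤-trans 0≤a a≤c) c≤b b≤c b≤1))))) ,
        eq

-- Pieces of cake

module _ {A : Set} {R : Rel A 0ℓ} where

  allPairs-++⁻ : ∀ xs {ys} → AllPairs R (xs ++ ys) →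
                 AllPairs R xs × AllPairs R ys × All (λ x → All (R x) ys) xs
  allPairs-++⁻ []       ps       = [] , ps , []
  allPairs-++⁻ (x ∷ xs) (p ∷ ps) with allPairs-++⁻ xs ps
  ... | pxs , pys , pxys = Allₚ.++⁻ˡ xs p ∷ pxs , pys , Allₚ.++⁻ʳ xs p ∷ pxys

  allPairs-↭ : Symmetric R → ∀ {xs ys} → xs ↭ ys → AllPairs R xs → AllPairs R ys
  allPairs-↭ sym Perm.refl          ps                     = ps
  allPairs-↭ sym (prep x xs↭ys)     (p ∷ ps)               = Permₚ.All-resp-↭ xs↭ys p ∷ allPairs-↭ sym xs↭ys ps
  allPairs-↭ sym (swap x y xs↭ys)   ((pxy ∷ px) ∷ py ∷ ps) =
    (sym pxy ∷ Permₚ.All-resp-↭ xs↭ys py) ∷ Permₚ.All-resp-↭ xs↭ys px ∷ allPairs-↭ sym xs↭ys ps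
  allPairs-↭ sym (Perm.trans p₁ p₂) ps                     = allPairs-↭ sym p₂ (allPairs-↭ sym p₁ ps)

module Flatten {A : Set} where
  private module Σ++ = IndicatorSum (Permₚ.++-commutativeMonoid {A = A})
  open import Algebra.Properties.CommutativeMonoid.Sum (Permₚ.++-commutativeMonoid {A = A}) using (sum)

  -- Being a sum in the monoid of lists up to permutation, it obeys `sum-update`, which describes
  -- how giving and clearing a share changes it.
  flatten : ∀ {n} → Vector (List A) n → List A
  flatten = sum

  flatten-update : ∀ {n} {B C : Vector (List A) n} {X} v → (∀ j → j ≢ v → B j ≡ C j) → B v ≡ X ++ C v →
                   flatten B ↭ X ++ flatten C
  flatten-update v B≡C Bv≡ = Σ++.sum-update v (λ j j≢v → ↭-reflexive (B≡C j j≢v)) (↭-reflexive Bv≡)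

  flatten-∈⁺ : ∀ {n} (B : Vector (List A) n) i {x} → x ∈ B i → x ∈ flatten B
  flatten-∈⁺ B zero    x∈ = ∈-++⁺ˡ x∈
  flatten-∈⁺ B (suc i) x∈ = ∈-++⁺ʳ (B zero) (flatten-∈⁺ (B ∘ suc) i x∈)

  flatten-any⁻ : ∀ {P : A → Set} {n} (B : Vector (List A) n) → Any P (flatten B) → ∃ λ i → Any P (B i)
  flatten-any⁻ {n = suc n} B p with Anyₚ.++⁻ (B zero) p
  ... | inj₁ q = zero , q
  ... | inj₂ q = let (i , r) = flatten-any⁻ (B ∘ suc) q in suc i , r

  flatten-pairs⁻ : ∀ {R : Rel A 0ℓ} {n} (B : Vector (List A) n) → AllPairs R (flatten B) → ∀ i → AllPairs R (B i)
  flatten-pairs⁻ B ps zero    = proj₁ (allPairs-++⁻ (B zero) ps)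
  flatten-pairs⁻ B ps (suc i) = flatten-pairs⁻ (B ∘ suc) (proj₁ (proj₂ (allPairs-++⁻ (B zero) ps))) i

  flatten-pairs⁻′ : ∀ {R : Rel A 0ℓ} → Symmetric R → ∀ {n} (B : Vector (List A) n) → AllPairs R (flatten B) →
                    ∀ i j → i ≢ j → ∀ {x y} → x ∈ B i → y ∈ B j → R x y
  flatten-pairs⁻′ sym B ps zero    zero    i≢j x∈ y∈ = ⊥-elim (i≢j refl)
  flatten-pairs⁻′ sym B ps zero    (suc j) i≢j x∈ y∈ =
    All.lookup (All.lookup (proj₂ (proj₂ (allPairs-++⁻ (B zero) ps))) x∈) (flatten-∈⁺ (B ∘ suc) j y∈)
  flatten-pairs⁻′ sym B ps (suc i) zero    i≢j x∈ y∈ = sym (flatten-pairs⁻′ sym B ps zero (suc i) (λ ()) y∈ x∈)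
  flatten-pairs⁻′ sym B ps (suc i) (suc j) i≢j x∈ y∈ =
    flatten-pairs⁻′ sym (B ∘ suc) (proj₁ (proj₂ (allPairs-++⁻ (B zero) ps))) i j (i≢j ∘ ≡.cong suc) x∈ y∈

module Pieces (lem : ExcludedMiddle 0ℓ) (𝓡 : CompleteOrderedField) where
  open CakeCutting lem 𝓡
  open RealProperties lem 𝓡
  open Integration lem 𝓡
  open Flatten
  open Interval
  open import Relation.Binary.Reasoning.Setoid setoid

  Disjoint : Interval → Interval → Set
  Disjoint J K = ∀ x → x ∈ᴵ J → x ∈ᴵ K → ⊥

  disjoint-sym : Symmetric Disjoint
  disjoint-sym d x x∈K x∈J = d x x∈J x∈K

  -- Disjointness and covering are tracked on a single list holding the table and all shares.
  -- Handing pieces over is then a permutation, and only cuts need an argument.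
  Tiling : Piece → Set
  Tiling X = AllPairs Disjoint X × (∀ x → 0# ≤ x → x ≤ 1# → x ∈ᴾ X)

  tiling-↭ : ∀ {X Y} → X ↭ Y → Tiling X → Tiling Y
  tiling-↭ X↭Y (ps , cover) = allPairs-↭ (λ {J} {K} → disjoint-sym {J} {K}) X↭Y ps , λ x 0≤x x≤1 → Permₚ.Any-resp-↭ X↭Y (cover x 0≤x x≤1)

  module _ {J : Interval} {c : ℝ} (lo<c : lo J < c) (c<hi : c < hi J) where

    ∈-leftOf : ∀ {x} → x ∈ᴵ leftOf J c lo<c c<hi → x ∈ᴵ J
    ∈-leftOf (lo≤x , inj₁ x<c)         = lo≤x , inj₁ (<-≤-trans x<c (proj₁ c<hi))
    -- The left part would contain its right end only if `c ≈ 1#`, but `c` lies strictly below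
    -- `hi J`, which is at most 1.
    ∈-leftOf (lo≤x , inj₂ (_ , c≈1)) = ⊥-elim (<⇒≱ c<hi (≤-respʳ-≈ (≈sym c≈1) (hi≤1 J)))

    ∈-rightOf : ∀ {x} → x ∈ᴵ rightOf J c lo<c c<hi → x ∈ᴵ J
    ∈-rightOf (c≤x , x<hi) = ≤-trans (proj₁ lo<c) c≤x , x<hi

    leftOf-rightOf-disjoint : Disjoint (leftOf J c lo<c c<hi) (rightOf J c lo<c c<hi)
    leftOf-rightOf-disjoint x (_ , inj₁ x<c)       (c≤x , _) = <⇒≱ x<c c≤x
    leftOf-rightOf-disjoint x (_ , inj₂ (_ , c≈1)) _         = <⇒≱ c<hi (≤-respʳ-≈ (≈sym c≈1) (hi≤1 J))

    ∈-leftOf-rightOf : ∀ {x} → x ∈ᴵ J → x ∈ᴵ leftOf J c lo<c c<hi ⊎ x ∈ᴵ rightOf J c lo<c c<hi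
    ∈-leftOf-rightOf {x} (lo≤x , x<hi) = side lem
      where
      side : Dec (c ≤ x) → x ∈ᴵ leftOf J c lo<c c<hi ⊎ x ∈ᴵ rightOf J c lo<c c<hi
      side (yes c≤x) = inj₂ (c≤x , x<hi)
      side (no ¬c≤x) = inj₁ (lo≤x , inj₁ (≰⇒> ¬c≤x))

    tiling-cut : ∀ {X} → Tiling (J ∷ X) → Tiling (leftOf J c lo<c c<hi ∷ rightOf J c lo<c c<hi ∷ X)
    tiling-cut {X} (d ∷ ds , cover) =
      (leftOf-rightOf-disjoint ∷ All.map (λ dJ x x∈ → dJ x (∈-leftOf x∈)) d) ∷
      All.map (λ dJ x x∈ → dJ x (∈-rightOf x∈)) d ∷ ds ,
      λ x 0≤x x≤1 → refine (cover x 0≤x x≤1)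
      where
      refine : ∀ {x} → x ∈ᴾ (J ∷ X) → x ∈ᴾ (leftOf J c lo<c c<hi ∷ rightOf J c lo<c c<hi ∷ X)
      refine (here x∈J) with ∈-leftOf-rightOf x∈J
      ... | inj₁ x∈ = here x∈
      ... | inj₂ x∈ = there (here x∈)
      refine (there x∈) = there (there x∈)

  tiling-cuts : ∀ {m X Y} Z → Cuts m X Y → Tiling (X ++ Z) → Tiling (Y ++ Z)
  tiling-cuts Z none t = t
  tiling-cuts Z (cut Xˡ J Xʳ c lo<c c<hi cs) t = tiling-cuts Z cs
    (tiling-↭ (Permₚ.++⁺ʳ Z (↭-sym (↭-trans (Permₚ.shift _ Xˡ (_ ∷ Xʳ)) (prep _ (Permₚ.shift _ Xˡ Xʳ)))))
      (tiling-cut lo<c c<hi (tiling-↭ (Permₚ.++⁺ʳ Z (Permₚ.shift J Xˡ Xʳ)) t)))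

  tiling-isAllocation : ∀ {n} (A : Shares n) → Tiling (flatten A) → IsAllocation A
  tiling-isAllocation A (ds , cover) = record
    { pieces   = flatten-pairs⁻ A ds
    ; disjoint = λ i j i≢j x x∈i x∈j →
        let (J , J∈ , x∈J) = find x∈i
            (K , K∈ , x∈K) = find x∈j
        in flatten-pairs⁻′ (λ {J} {K} → disjoint-sym {J} {K}) A ds i j i≢j J∈ K∈ x x∈J x∈K
    ; covering = λ x 0≤x x≤1 → flatten-any⁻ A (cover x 0≤x x≤1)
    }

  tiling-whole : Tiling (whole ∷ [])
  tiling-whole = [] ∷ [] , λ x 0≤x x≤1 → here (0≤x , last x x≤1)
    where
    last : ∀ x → x ≤ 1# → x < 1# ⊎ (x ≈ 1# × 1# ≈ 1#)
    last x x≤1 with lem {x ≈ 1#}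
    ... | yes x≈1 = inj₂ (x≈1 , ≈refl)
    ... | no  x≉1 = inj₁ (x≤1 , x≉1)

  cuts-∷ : ∀ {m X Y} K → Cuts m X Y → Cuts m (K ∷ X) (K ∷ Y)
  cuts-∷ K none                          = none
  cuts-∷ K (cut Xˡ J Xʳ c lo<c c<hi cs) = cut (K ∷ Xˡ) J Xʳ c lo<c c<hi (cuts-∷ K cs)

  cuts-++ : ∀ {m X Y} Z → Cuts m X Y → Cuts m (Z ++ X) (Z ++ Y)
  cuts-++ []      cs = cs
  cuts-++ (K ∷ Z) cs = cuts-∷ K (cuts-++ Z cs)

  cuts-trans : ∀ {l m X Y Z} → Cuts l X Y → Cuts m Y Z → Cuts (l ℕ.+ m) X Z
  cuts-trans none                          ds = ds
  cuts-trans (cut Xˡ J Xʳ c lo<c c<hi cs) ds = cut Xˡ J Xʳ c lo<c c<hi (cuts-trans cs ds)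

  -- Values of pieces, equal slicing and choosing the best pieces

  module Valuation (D : Density) where
    open DensityIntegral D
    open Density D using (v)

    V : Piece → ℝ
    V = value D

    interval-nonNeg : ∀ J → 0# ≤ ∫ v (lo J) (hi J)
    interval-nonNeg J = ∫-nonNeg (0≤lo J) (proj₁ (lo<hi J)) (hi≤1 J)

    value-nonNeg : ∀ X → 0# ≤ V X
    value-nonNeg []      = ≤-refl
    value-nonNeg (J ∷ X) = +-nonNeg (interval-nonNeg J) (value-nonNeg X)

    value-++ : ∀ X Y → V (X ++ Y) ≈ V X + V Y
    value-++ []      Y = ≈sym (+-identityˡ _)
    value-++ (J ∷ X) Y = ≈trans (+-congˡ (value-++ X Y)) (≈sym (+-assoc _ _ _))

    value-↭ : ∀ {X Y} → X ↭ Y → V X ≈ V Y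
    value-↭ Perm.refl          = ≈refl
    value-↭ (prep J X↭Y)       = +-congˡ (value-↭ X↭Y)
    value-↭ (swap J K X↭Y)     = ≈trans (≈sym (+-assoc _ _ _))
      (≈trans (+-cong (+-comm _ _) (value-↭ X↭Y)) (+-assoc _ _ _))
    value-↭ (Perm.trans p₁ p₂) = ≈trans (value-↭ p₁) (value-↭ p₂)

    value-cut : ∀ J c → lo J < c → c < hi J → ∫ v (lo J) (hi J) ≈ ∫ v (lo J) c + ∫ v c (hi J)
    value-cut J c lo<c c<hi = ∫-additive (0≤lo J) (proj₁ lo<c) (proj₁ c<hi) (hi≤1 J)

    value-cuts : ∀ {m X Y} → Cuts m X Y → V X ≈ V Y
    value-cuts none = ≈refl
    value-cuts (cut Xˡ J Xʳ c lo<c c<hi cs) = ≈trans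
      (≈trans (value-++ Xˡ (J ∷ Xʳ)) (≈trans (+-congˡ (≈trans (+-congʳ (value-cut J c lo<c c<hi)) (+-assoc _ _ _)))
        (≈sym (value-++ Xˡ (leftOf J c lo<c c<hi ∷ rightOf J c lo<c c<hi ∷ Xʳ)))))
      (value-cuts cs)

    value-concat-≤ : ∀ {w} Xs → All (λ X → V X ≤ w) Xs → V (concat Xs) ≤ fromℕ (length Xs) * w
    value-concat-≤ []       []       = ≤-reflexive (≈sym (zeroˡ _))
    value-concat-≤ {w} (X ∷ Xs) (p ∷ ps) = ≤-respˡ-≈ (≈sym (value-++ X (concat Xs)))
      (≤-respʳ-≈ (solve 2 (λ w k → w :+ k :* w := (con ℤ.1ℤ :+ k) :* w) ≈refl w (fromℕ (length Xs)))
        (+-mono p (value-concat-≤ Xs ps)))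

    value-concat-≥ : ∀ {w} Xs → All (λ X → w ≤ V X) Xs → fromℕ (length Xs) * w ≤ V (concat Xs)
    value-concat-≥ []       []       = ≤-reflexive (zeroˡ _)
    value-concat-≥ {w} (X ∷ Xs) (p ∷ ps) = ≤-respʳ-≈ (≈sym (value-++ X (concat Xs)))
      (≤-respˡ-≈ (solve 2 (λ w k → w :+ k :* w := (con ℤ.1ℤ :+ k) :* w) ≈refl w (fromℕ (length Xs)))
        (+-mono p (value-concat-≥ Xs ps)))

    value-concat : ∀ {w} Xs → All (λ X → V X ≈ w) Xs → V (concat Xs) ≈ fromℕ (length Xs) * w
    value-concat Xs ps = antisym (value-concat-≤ Xs (All.map ≤-reflexive ps))
                                 (value-concat-≥ Xs (All.map (≤-reflexive ∘ ≈sym) ps))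

    -- The intervals are laid side by side: they are taken whole while they fit, and the first one
    -- that exceeds the remaining target is cut once. If that target is 0 there is no interior point
    -- to cut at, and none is needed.
    split : ∀ X w → 0# ≤ w → w ≤ V X →
            ∃₂ λ Y Z → ∃ λ m → m ℕ.≤ 1 × Cuts m X (Y ++ Z) × V Y ≈ w
    split []      w 0≤w w≤ = [] , [] , 0 , ℕ.z≤n , none , antisym 0≤w w≤
    split (J ∷ X) w 0≤w w≤ = first lem lem
      where
      a : ℝ
      a = ∫ v (lo J) (hi J)

      Goal : Set
      Goal = ∃₂ λ Y Z → ∃ λ m → m ℕ.≤ 1 × Cuts m (J ∷ X) (Y ++ Z) × V Y ≈ w

      extend : (∃₂ λ Y Z → ∃ λ m → m ℕ.≤ 1 × Cuts m X (Y ++ Z) × V Y ≈ w + - a) → Goal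
      extend (Y , Z , m , m≤1 , cs , eq) = J ∷ Y , Z , m , m≤1 , cuts-∷ J cs ,
        ≈trans (+-congˡ eq) (solve 2 (λ a w → a :+ (w :- a) := w) ≈refl a w)

      bisect : (∃ λ c → lo J < c × c < hi J × ∫ v (lo J) c ≈ w) → Goal
      bisect (c , lo<c , c<hi , eq) = leftOf J c lo<c c<hi ∷ [] , rightOf J c lo<c c<hi ∷ X , 1 , ℕₚ.≤-refl ,
        cut [] J X c lo<c c<hi none , ≈trans (+-identityʳ _) eq

      first : Dec (a ≤ w) → Dec (0# < w) → Goal
      first (yes a≤w) _ = extend (split X (w + - a) (difference-nonNeg a≤w)
        (shift w≤ (solve 3 (λ x w a → x :- (w :- a) := (a :+ x) :- w) ≈refl (V X) w a)))
      first (no ¬a≤w) (yes 0<w) = bisect (intermediateValue-strict (0≤lo J) (proj₁ (lo<hi J)) (hi≤1 J) 0<w (≰⇒> ¬a≤w))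
      first (no ¬a≤w) (no ¬0<w) = [] , J ∷ X , 0 , ℕ.z≤n , none , antisym 0≤w (≮⇒≥ ¬0<w)

    EqualSlices : ℕ → Piece → ℝ → Set
    EqualSlices p X w = ∃ λ m → ∃₂ λ Y Xs → m ℕ.< suc p × Cuts m X Y × concat Xs ↭ Y ×
                        length Xs ≡ suc p × All (λ X → V X ≈ w) Xs

    -- One split, of at most one cut, for each slice but the last: what is left then has value `w`
    -- by subtraction. Hence at most `p` cuts for `suc p` slices.
    equalSlices : ∀ p X w → 0# ≤ w → V X ≈ fromℕ (suc p) * w → EqualSlices p X w
    equalSlices zero X w 0≤w eq = 0 , X , X ∷ [] , ℕ.s≤s ℕ.z≤n , none , ↭-reflexive (Listₚ.++-identityʳ X) , refl ,
      ≈trans eq (solve 1 (λ w → (con ℤ.1ℤ :+ con ℤ.0ℤ) :* w := w) ≈refl w) ∷ []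
    equalSlices (suc p) X w 0≤w eq = firstSlice (split X w 0≤w (≤-respʳ-≈ (≈sym eq′)
        (x≤x+y (*-nonNeg _ _ (fromℕ-nonNeg (suc p)) 0≤w))))
      where
      eq′ : V X ≈ w + fromℕ (suc p) * w
      eq′ = ≈trans eq (solve 2 (λ k w → (con ℤ.1ℤ :+ k) :* w := w :+ k :* w) ≈refl (fromℕ (suc p)) w)

      rest : ∀ Y Z {l} → l ℕ.≤ 1 → Cuts l X (Y ++ Z) → V Y ≈ w → EqualSlices p Z w → EqualSlices (suc p) X w
      rest Y Z l≤1 cs eqY (m , Y′ , Xs , m< , cs′ , perm , len , all) =
        _ , Y ++ Y′ , Y ∷ Xs , ℕₚ.+-mono-≤-< l≤1 m< , cuts-trans cs (cuts-++ Y cs′) , Permₚ.++⁺ˡ Y perm ,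
        ≡.cong suc len , eqY ∷ all

      firstSlice : (∃₂ λ Y Z → ∃ λ l → l ℕ.≤ 1 × Cuts l X (Y ++ Z) × V Y ≈ w) → EqualSlices (suc p) X w
      firstSlice (Y , Z , l , l≤1 , cs , eqY) = rest Y Z l≤1 cs eqY (equalSlices p Z w 0≤w (begin
        V Z                              ≈⟨ solve 2 (λ y z → z := (y :+ z) :- y) ≈refl (V Y) (V Z) ⟩
        (V Y + V Z) + - V Y              ≈⟨ +-cong (≈sym (≈trans (value-cuts cs) (value-++ Y Z))) (-‿cong eqY) ⟩
        V X + - w                        ≈⟨ +-congʳ eq′ ⟩
        (w + fromℕ (suc p) * w) + - w    ≈⟨ solve 2 (λ k w → (w :+ k) :- w := k) ≈refl (fromℕ (suc p) * w) w ⟩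
        fromℕ (suc p) * w                ∎))

    slicesExist : ∀ X p → ∃ λ m → ∃₂ λ Y Xs → Cuts m X Y × m ℕ.< suc p × concat Xs ↭ Y × length Xs ≡ suc p ×
                  (∃ λ w → All (λ X → V X ≈ w) Xs)
    slicesExist X p = reorder (equalSlices p X w
        (*-nonNeg _ _ (⁻¹-nonNeg (fromℕ-positive p)) (value-nonNeg X)) (≈sym (begin
          fromℕ (suc p) * w                         ≈⟨ solve 3 (λ k i x → k :* (i :* x) := (i :* k) :* x) ≈refl
                                                         (fromℕ (suc p)) (fromℕ (suc p) ⁻¹) (V X) ⟩
          (fromℕ (suc p) ⁻¹ * fromℕ (suc p)) * V X  ≈⟨ *-congʳ (*-inverseˡ (fromℕ-positive p)) ⟩
          1# * V X                                  ≈⟨ *-identityˡ _ ⟩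
          V X                                       ∎)))
      where
      w : ℝ
      w = fromℕ (suc p) ⁻¹ * V X
      reorder : EqualSlices p X w → _
      reorder (m , Y , Xs , m< , cs , perm , len , all) = m , Y , Xs , cs , m< , perm , len , w , all

    decreasing : DecTotalOrder 0ℓ 0ℓ 0ℓ
    decreasing = On.decTotalOrder (Flip.decTotalOrder (record
      { isDecTotalOrder = record { isTotalOrder = isTotalOrder ; _≟_ = λ _ _ → lem ; _≤?_ = λ _ _ → lem } })) V

    mostValuable : ∀ k Xs → k ℕ.≤ length Xs → ∃₂ λ Ys Zs → Xs ↭ Ys ++ Zs × length Ys ≡ k ×
                   All (λ Y → All (λ Z → V Z ≤ V Y) Zs) Ys
    mostValuable k Xs k≤ = List.take k Ss , List.drop k Ss ,
      ↭-trans (↭-sym (sort-↭ Xs)) (↭-reflexive (≡.sym (Listₚ.take++drop≡id k Ss))) ,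
      ≡.trans (Listₚ.length-take k Ss) (ℕₚ.m≤n⇒m⊓n≡m (ℕₚ.≤-trans k≤ (ℕₚ.≤-reflexive (≡.sym (Permₚ.↭-length (sort-↭ Xs)))))) ,
      proj₂ (proj₂ (allPairs-++⁻ (List.take k Ss) (≡.subst (AllPairs (λ Y Z → V Z ≤ V Y)) (≡.sym (Listₚ.take++drop≡id k Ss))
        (Linked⇒AllPairs (λ Y≥Z Z≥W → ≤-trans Z≥W Y≥Z) (sort-↗ Xs)))))
      where
      open Sort decreasing using (sort; sort-↭; sort-↗)
      Ss : List Piece
      Ss = sort Xs

    -- The least value of a taken piece separates the two lists. This one number bounds from above
    -- each piece left and from below each piece taken.
    threshold : ∀ Ys Zs → 1 ℕ.≤ length Ys → All (λ Y → All (λ Z → V Z ≤ V Y) Zs) Ys →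
                ∃ λ w → 0# ≤ w × All (λ Z → V Z ≤ w) Zs × All (λ Y → w ≤ V Y) Ys
    threshold (Y ∷ [])      Zs _ (p ∷ []) = V Y , value-nonNeg Y , p , ≤-refl ∷ []
    threshold (Y ∷ Y′ ∷ Ys) Zs _ (p ∷ ps) = smaller (threshold (Y′ ∷ Ys) Zs (ℕ.s≤s ℕ.z≤n) ps)
      where
      smaller : (∃ λ w → 0# ≤ w × All (λ Z → V Z ≤ w) Zs × All (λ Y → w ≤ V Y) (Y′ ∷ Ys)) → _
      smaller (w , 0≤w , qs , rs) = pick (total (V Y) w)
        where
        pick : V Y ≤ w ⊎ w ≤ V Y → ∃ λ w → 0# ≤ w × All (λ Z → V Z ≤ w) Zs × All (λ Y → w ≤ V Y) (Y ∷ Y′ ∷ Ys)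
        pick (inj₁ VY≤w) = V Y , value-nonNeg Y , p , ≤-refl ∷ All.map (≤-trans VY≤w) rs
        pick (inj₂ w≤VY) = w , 0≤w , qs , w≤VY ∷ rs

-- Invariants of the algorithm

module Execution (lem : ExcludedMiddle 0ℓ) (𝓡 : CompleteOrderedField) {n : ℕ} (T : RootedTree n)
                 (D : Fin n → CakeCutting.Density lem 𝓡) where
  open CakeCutting lem 𝓡
  open AlgDescendantGraph T D renaming (begin to begin-execution)
  open RootedTree T
  open TreeProperties T
  open PieceCounts lem 𝓡 T D
  open RealProperties lem 𝓡
  open Pieces lem 𝓡
  open Flatten
  module Val (i : Fin n) = Valuation (D i)
  open Val hiding (V)
  module ΣN = IndicatorSum ℕₚ.+-0-commutativeMonoid
  module ΣR = IndicatorSum +-commutativeMonoid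
  open import Algebra.Properties.CommutativeMonoid.Sum +-commutativeMonoid using (sum-cong-≋) renaming (sum to ∑)
  open import Algebra.Properties.CommutativeMonoid.Sum ℕₚ.+-0-commutativeMonoid using () renaming (sum to ∑ℕ)
  open import Relation.Binary.Reasoning.Setoid setoid hiding (start)

  open import Algebra.Properties.CommutativeSemigroup ℕₚ.+-commutativeSemigroup using () renaming (x∙yz≈y∙xz to +-left-comm)

  N! : ℕ
  N! = treeDepth !

  byCases : {P C : Set} → (P → C) → (¬ P → C) → C
  byCases {P} yes! no! = decide lem
    where
    decide : Dec P → _
    decide (yes p) = yes! p
    decide (no ¬p) = no! ¬p

  Counted : List (Fin n) → Fin n → Fin n → Set
  Counted us i j = i ≼ j ⊎ (j AncestorOf i × j ∉ us)

  -- us lists the unprocessed vertices.  The ancestors of i still in us will pass their cake on, hence do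
  -- not count yet.
  Φ : List (Fin n) → Shares n → Fin n → ℝ
  Φ us A i = ∑ λ j → ΣR.when (lem {Counted us i j}) (V i (A j))

  weight : {P : Set} → Dec P → Fin n → ℕ
  weight (yes _) i = suc (depth i)
  weight (no _)  i = depth i ℕ.+ subtreeSize i

  coef : List (Fin n) → Fin n → ℝ
  coef us i = fromℕ (weight (lem {i ∈ us}) i)

  Fair : List (Fin n) → Shares n → Fin n → Set
  Fair us A i = Φ us A i ≤ coef us i * V i (A i)

  weight-yes : ∀ {P : Set} (P? : Dec P) i → P → weight P? i ≡ suc (depth i)
  weight-yes (yes _) i p = refl
  weight-yes (no ¬p) i p = ⊥-elim (¬p p)

  weight-no : ∀ {P : Set} (P? : Dec P) i → ¬ P → weight P? i ≡ depth i ℕ.+ subtreeSize i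
  weight-no (yes p) i ¬p = ⊥-elim (¬p p)
  weight-no (no _)  i ¬p = refl

  weight-cong : ∀ {P Q : Set} (P? : Dec P) (Q? : Dec Q) i → (P → Q) → (Q → P) → weight P? i ≡ weight Q? i
  weight-cong (yes p) Q? i to from = ≡.sym (weight-yes Q? i (to p))
  weight-cong (no ¬p) Q? i to from = ≡.sym (weight-no Q? i (¬p ∘ from))

  coef-∈ : ∀ {us i} → i ∈ us → coef us i ≡ fromℕ (suc (depth i))
  coef-∈ i∈ = ≡.cong fromℕ (weight-yes lem _ i∈)

  coef-∉ : ∀ {us i} → i ∉ us → coef us i ≡ fromℕ (depth i ℕ.+ subtreeSize i)
  coef-∉ i∉ = ≡.cong fromℕ (weight-no lem _ i∉)

  ∈-strip : ∀ {i u : Fin n} {us} → i ≢ u → i ∈ u ∷ us → i ∈ us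
  ∈-strip i≢u (here i≡u) = ⊥-elim (i≢u i≡u)
  ∈-strip i≢u (there i∈) = i∈

  coef-∷ : ∀ {u us i} → i ≢ u → coef (u ∷ us) i ≡ coef us i
  coef-∷ i≢u = ≡.cong fromℕ (weight-cong lem lem _ (∈-strip i≢u) there)

  give-same : ∀ v X (A : Shares n) → give v X A v ≡ X ++ A v
  give-same v X A = updateAt-updates v A

  give-other : ∀ {j v} X (A : Shares n) → j ≢ v → give v X A j ≡ A j
  give-other {j} {v} X A j≢v = updateAt-minimal j v A j≢v

  value-≡ : ∀ i {X Y} → X ≡ Y → V i X ≈ V i Y
  value-≡ i X≡Y = ≈reflexive (≡.cong (V i) X≡Y)

  value-give : ∀ i v X (A : Shares n) → V i (give v X A v) ≈ V i X + V i (A v)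
  value-give i v X A = ≈trans (value-≡ i (give-same v X A)) (value-++ i X (A v))

  Φ-give : ∀ {us v X A} i → Counted us i v → Φ us (give v X A) i ≈ V i X + Φ us A i
  Φ-give {us} {v} {X} {A} i c = ΣR.sum-update v
    (λ j j≢v → ΣR.when-cong lem lem (λ p → p) (λ p → p) λ _ → value-≡ i (give-other X A j≢v))
    (≈trans (ΣR.when-yes lem c) (≈trans (value-give i v X A) (+-congˡ (≈sym (ΣR.when-yes lem c)))))

  Φ-give-uncounted : ∀ {us v X A} i → ¬ Counted us i v → Φ us (give v X A) i ≈ Φ us A i
  Φ-give-uncounted {us} {v} {X} {A} i ¬c = sum-cong-≋ {n} same
    where
    same : ∀ j → ΣR.when (lem {Counted us i j}) (V i (give v X A j)) ≈ ΣR.when (lem {Counted us i j}) (V i (A j))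
    same j = ΣR.when-cong lem lem (λ p → p) (λ p → p) λ c → value-≡ i (give-other X A λ { refl → ¬c c })

  clear : Fin n → Shares n → Shares n
  clear u A = Vector.updateAt A u (λ _ → [])

  clear-same : ∀ u (A : Shares n) → clear u A u ≡ []
  clear-same u A = updateAt-updates u A

  clear-other : ∀ {j u} (A : Shares n) → j ≢ u → clear u A j ≡ A j
  clear-other {j} {u} A j≢u = updateAt-minimal j u A j≢u

  counted-∷ : ∀ {u us i j} → j ≢ u → Counted (u ∷ us) i j → Counted us i j
  counted-∷ j≢u (inj₁ i≼j)          = inj₁ i≼j
  counted-∷ j≢u (inj₂ (ji , j∉u∷us)) = inj₂ (ji , j∉u∷us ∘ there)

  counted-∷⁺ : ∀ {u us i j} → j ≢ u → Counted us i j → Counted (u ∷ us) i j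
  counted-∷⁺ j≢u (inj₁ i≼j)        = inj₁ i≼j
  counted-∷⁺ j≢u (inj₂ (ji , j∉us)) = inj₂ (ji , j∉us ∘ ∈-strip j≢u)

  value-clear : ∀ {us u} i (A : Shares n) → ΣR.when (lem {Counted us i u}) (V i (clear u A u)) ≈ 0#
  value-clear {us} {u} i A = ΣR.when-0 (lem {Counted us i u}) (value-≡ i (clear-same u A))

  Φ-clear : ∀ {u us A} i → i ≼ u → Φ (u ∷ us) A i ≈ V i (A u) + Φ us (clear u A) i
  Φ-clear {u} {us} {A} i i≼u = ΣR.sum-update u
    (λ j j≢u → ΣR.when-cong lem lem (counted-∷ j≢u) (counted-∷⁺ j≢u) λ _ → value-≡ i (≡.sym (clear-other A j≢u)))
    (≈trans (ΣR.when-yes lem (inj₁ i≼u)) (≈trans (≈sym (+-identityʳ _)) (+-congˡ (≈sym (value-clear {us} i A)))))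

  -- If `u` is a proper ancestor of `i`, it starts to count for `i` at this very moment, but with an
  -- empty share, since its cake has gone to the table.
  Φ-clear-uncounted : ∀ {u us A} i → ¬ (i ≼ u) → Φ (u ∷ us) A i ≈ Φ us (clear u A) i
  Φ-clear-uncounted {u} {us} {A} i ¬i≼u = ≈trans (ΣR.sum-update {a = 0#} u
    (λ j j≢u → ΣR.when-cong lem lem (counted-∷ j≢u) (counted-∷⁺ j≢u) λ _ → value-≡ i (≡.sym (clear-other A j≢u)))
    (≈trans (ΣR.when-no lem λ { (inj₁ i≼u) → ¬i≼u i≼u ; (inj₂ (_ , u∉)) → u∉ (here refl) })
      (≈trans (≈sym (+-identityʳ 0#)) (+-congˡ (≈sym (value-clear {us} i A))))))
    (+-identityˡ _)

  -- The order by depth says nothing about vertices outside the list. `closed` adds that those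
  -- taking from `u` are still unprocessed, which fixes their coefficient at `suc (depth i)` and
  -- keeps them from counting as processed ancestors.
  record Queue (us : List (Fin n)) : Set where
    field
      unique  : Unique us
      ordered : AllPairs (λ v w → depth v ℕ.≤ depth w) us
      closed  : ∀ {u w} → u ∈ us → u AncestorOf w → w ∈ us

  module _ {u us} (q : Queue (u ∷ us)) where
    open Queue q

    head-∉ : u ∉ us
    head-∉ u∈ = All.lookup (AllPairs.head unique) u∈ refl

    head-depth : ∀ {w} → w ∈ us → depth u ℕ.≤ depth w
    head-depth = All.lookup (AllPairs.head ordered)

    head-descendant : ∀ {w} → u AncestorOf w → w ∈ us
    head-descendant uw = ∈-strip (λ { refl → ancestor-irrefl uw }) (closed (here refl) uw)

    head-ancestor : ∀ {i} → i AncestorOf u → i ∉ us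
    head-ancestor iu i∈ = ℕₚ.<⇒≱ (ancestor-depth iu) (head-depth i∈)

    queue-tail : Queue us
    queue-tail = record
      { unique  = AllPairs.tail unique
      ; ordered = AllPairs.tail ordered
      ; closed  = λ x∈ xw → ∈-strip (λ { refl → head-ancestor xw x∈ }) (closed (there x∈) xw)
      }

  record ReadyInv (us : List (Fin n)) (A : Shares n) (k : ℕ) : Set where
    field
      queue    : Queue us
      tiling   : Tiling (flatten A)
      -- A budget of `n * N!` cuts is reserved for each vertex still to be processed.
      cutCount : k ℕ.+ length us ℕ.* (n ℕ.* N!) ℕ.≤ n ℕ.* (n ℕ.* N!)
      fair     : ∀ i → Fair us A i

  remaining : Fin n → List (Fin n) → ℕ
  remaining i vs = ΣN.sumᴸ (map (λ w → ΣN.when (i ⋖? w) (share w)) vs)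

  -- For a proper descendant i of u who has taken her pieces of X^u, m bounds her value of each piece left;
  -- d! + remaining i vs is the number of these that will go to u and to T(i).
  record SharingInv (u : Fin n) (Xs : List Piece) (vs us : List (Fin n)) (A : Shares n) (k : ℕ) : Set where
    field
      queue     : Queue (u ∷ us)
      unique    : Unique vs
      ordered   : AllPairs (λ v w → depth v ℕ.≤ depth w) vs
      below     : ∀ {v} → v ∈ vs → u AncestorOf v
      count     : length Xs ≡ N! ℕ.+ ΣN.sumᴸ (map share vs)
      tiling    : Tiling (concat Xs ++ flatten A)
      cutCount  : k ℕ.+ length us ℕ.* (n ℕ.* N!) ℕ.≤ n ℕ.* (n ℕ.* N!)
      empty     : A u ≡ []
      -- `fromℕ N! * w` is what `u` will finally keep; her own share is empty until then.
      slicer    : ∃ λ w → All (λ X → V u X ≈ w) Xs ×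
                  Φ us A u + V u (concat Xs) ≤ fromℕ (depth u ℕ.+ subtreeSize u) * (fromℕ N! * w)
      -- The whole table is charged to `i`, as all of it will end up in her subtree.
      ancestor  : ∀ i → i AncestorOf u → Φ us A i + V i (concat Xs) ≤ coef us i * V i (A i)
      unserved  : ∀ i → i ≢ u → ¬ (i AncestorOf u) → (u AncestorOf i → i ∈ vs) → Fair us A i
      served    : ∀ i → u AncestorOf i → i ∉ vs → ∃ λ m → All (λ X → V i X ≤ m) Xs ×
                  Φ us A i + fromℕ (N! ℕ.+ remaining i vs) * m ≤ coef us i * V i (A i)

  sumᴸ-≤-sum : ∀ (h : Fin n → ℕ) {vs} → Unique vs → ΣN.sumᴸ (map h vs) ℕ.≤ ∑ℕ h
  sumᴸ-≤-sum h {vs} u = ℕₚ.≤-trans (ℕₚ.≤-reflexive (ΣN.sumᴸ-unique (λ j → lem {j ∈ vs}) h u (λ _ j∈ → j∈) (λ _ j∈ → j∈)))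
    (sum-mono λ j → when-≤ (lem {j ∈ vs}))
    where
    when-≤ : ∀ {P : Set} (P? : Dec P) {x} → ΣN.when P? x ℕ.≤ x
    when-≤ (yes _) = ℕₚ.≤-refl
    when-≤ (no _)  = ℕ.z≤n

  -- Vertices of `vs` outside the subtree of `i` contribute nothing, and those inside are among the
  -- summands of `f-shares`.
  remaining-≤ : ∀ i {vs} → Unique vs → N! ℕ.+ remaining i vs ℕ.≤ f i
  remaining-≤ i u = ℕₚ.≤-trans (ℕₚ.+-monoʳ-≤ N! (sumᴸ-≤-sum (λ w → ΣN.when (i ⋖? w) (share w)) u)) (ℕₚ.≤-reflexive (f-shares i))

  Fair-resp : ∀ {us us′ A A′ i} → Φ us A i ≈ Φ us′ A′ i → coef us i ≡ coef us′ i → A i ≡ A′ i → Fair us A i → Fair us′ A′ i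
  Fair-resp {i = i} Φ≈ c≡ A≡ fair = ≤-respˡ-≈ Φ≈ (≤-respʳ-≈ (≈reflexive (≡.cong₂ (λ c X → c * V i X) c≡ A≡)) fair)

  -- Preservation of the invariants by slicing, taking and keeping

  module Slice {u us A k m Y Xs vs} (inv : ReadyInv (u ∷ us) A k)
               (cuts : Cuts m (A u) Y) (m<f : m ℕ.< f u) (perm : concat Xs ↭ Y) (len : length Xs ≡ f u)
               (equal : ∃ λ w → All (λ X → V u X ≈ w) Xs) (byDepth : ByDepth T (u AncestorOf_) vs) where
    open ReadyInv inv
    open ByDepth byDepth using (unique; exactly; ordered)

    A′ : Shares n
    A′ = clear u A

    value-slices : ∀ i → V i (A u) ≈ V i (concat Xs)
    value-slices i = ≈trans (value-cuts i cuts) (≈sym (value-↭ i perm))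

    slice-tiling : Tiling (concat Xs ++ flatten A′)
    slice-tiling = tiling-↭ (Permₚ.++⁺ʳ (flatten A′) (↭-sym perm)) (tiling-cuts (flatten A′) cuts
      (tiling-↭ (flatten-update u (λ j j≢u → ≡.sym (clear-other A j≢u))
        (≡.sym (≡.trans (≡.cong (A u ++_) (clear-same u A)) (Listₚ.++-identityʳ (A u))))) tiling))

    slice-count : length Xs ≡ N! ℕ.+ ΣN.sumᴸ (map share vs)
    slice-count = ≡.trans len (≡.trans (≡.sym (f-shares u)) (≡.cong (N! ℕ.+_) (≡.sym
      (ΣN.sumᴸ-unique (u ⋖?_) share unique (λ v → Equivalence.to (exactly v)) (λ v → Equivalence.from (exactly v))))))

    slice-cutCount : (k ℕ.+ m) ℕ.+ length us ℕ.* (n ℕ.* N!) ℕ.≤ n ℕ.* (n ℕ.* N!)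
    slice-cutCount = ℕₚ.≤-trans (ℕₚ.≤-trans (ℕₚ.≤-reflexive (ℕₚ.+-assoc k m _))
      (ℕₚ.+-monoʳ-≤ k (ℕₚ.+-monoˡ-≤ (length us ℕ.* (n ℕ.* N!)) (ℕₚ.≤-trans (ℕₚ.<⇒≤ m<f) (f≤n*treeDepth! u))))) cutCount

    Φ-slice : ∀ i → i ≼ u → Φ us A′ i + V i (concat Xs) ≤ coef (u ∷ us) i * V i (A i)
    Φ-slice i i≼u = ≤-respˡ-≈ (≈trans (Φ-clear i i≼u) (≈trans (+-comm _ _) (+-congˡ (value-slices i)))) (fair i)

    -- The old bound is `suc (depth u)` times `f u` slices. By `f-*` this equals
    -- `depth u + subtreeSize u` times `N!` slices, so the bound is unchanged although she will keep
    -- only `N!` of them.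
    slice-slicer : ∃ λ w → All (λ X → V u X ≈ w) Xs ×
                   Φ us A′ u + V u (concat Xs) ≤ fromℕ (depth u ℕ.+ subtreeSize u) * (fromℕ N! * w)
    slice-slicer = w , proj₂ equal , ≤-respʳ-≈ (begin
        coef (u ∷ us) u * V u (A u)                       ≈⟨ *-cong (≈reflexive (coef-∈ (here refl))) (value-slices u) ⟩
        fromℕ (suc (depth u)) * V u (concat Xs)           ≈⟨ *-congˡ (≈trans (value-concat u Xs (proj₂ equal))
                                                               (*-congʳ (≈reflexive (≡.cong fromℕ len)))) ⟩
        fromℕ (suc (depth u)) * (fromℕ (f u) * w)         ≈⟨ *-assoc _ _ _ ⟨
        (fromℕ (suc (depth u)) * fromℕ (f u)) * w         ≈⟨ *-congʳ (fromℕ-* (suc (depth u)) (f u)) ⟨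
        fromℕ (suc (depth u) ℕ.* f u) * w
          ≈⟨ *-congʳ (≈reflexive (≡.cong fromℕ (≡.trans (ℕₚ.*-comm (suc (depth u)) (f u)) (f-* u)))) ⟩
        fromℕ ((depth u ℕ.+ subtreeSize u) ℕ.* N!) * w    ≈⟨ *-congʳ (fromℕ-* (depth u ℕ.+ subtreeSize u) N!) ⟩
        (fromℕ (depth u ℕ.+ subtreeSize u) * fromℕ N!) * w ≈⟨ *-assoc _ _ _ ⟩
        fromℕ (depth u ℕ.+ subtreeSize u) * (fromℕ N! * w) ∎)
      (Φ-slice u (inj₁ refl))
      where
      w : ℝ
      w = proj₁ equal

    sliced : SharingInv u Xs vs us A′ (k ℕ.+ m)
    sliced = record
      { queue    = queue
      ; unique   = unique
      ; ordered  = ordered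
      ; below    = λ {v} → Equivalence.to (exactly v)
      ; count    = slice-count
      ; tiling   = slice-tiling
      ; cutCount = slice-cutCount
      ; empty    = clear-same u A
      ; slicer   = slice-slicer
      ; ancestor = λ i iu → let i≢u = λ { refl → ancestor-irrefl iu } in
          ≤-respʳ-≈ (≈reflexive (≡.cong₂ (λ c X → c * V i X) (coef-∷ {us = us} i≢u) (≡.sym (clear-other A i≢u))))
            (Φ-slice i (inj₂ iu))
      ; unserved = λ i i≢u ¬iu _ →
          Fair-resp {us = u ∷ us} {us′ = us} {A = A} {A′ = A′} {i = i}
            (Φ-clear-uncounted i λ { (inj₁ u≡i) → i≢u (≡.sym u≡i) ; (inj₂ iu) → ¬iu iu })
            (coef-∷ i≢u) (≡.sym (clear-other A i≢u)) (fair i)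
      ; served   = λ i ui i∉vs → ⊥-elim (i∉vs (Equivalence.from (exactly i) ui))
      }

  module Take {u Xs Ys Zs v vs us A k} (inv : SharingInv u Xs (v ∷ vs) us A k)
              (perm : Xs ↭ Ys ++ Zs) (len : length Ys ℕ.* depth v ≡ f v)
              (best : All (λ Y → All (λ Z → V v Z ≤ V v Y) Zs) Ys) where
    open SharingInv inv

    A′ : Shares n
    A′ = give v (concat Ys) A

    uv : u AncestorOf v
    uv = below (here refl)

    1≤depth : 1 ℕ.≤ depth v
    1≤depth = ℕₚ.≤-trans (ℕ.s≤s ℕ.z≤n) (ancestor-depth uv)

    v∈us : v ∈ us
    v∈us = head-descendant queue uv

    v≢u : v ≢ u
    v≢u refl = ancestor-irrefl uv

    v∉vs : v ∉ vs
    v∉vs v∈ = All.lookup (AllPairs.head unique) v∈ refl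

    v-depth : ∀ {w} → w ∈ vs → depth v ℕ.≤ depth w
    v-depth = All.lookup (AllPairs.head ordered)

    length-Ys : length Ys ≡ share v
    length-Ys = ℕₚ.*-cancelʳ-≡ (length Ys) (share v) (depth v) {{ℕ.>-nonZero 1≤depth}} (≡.trans len (≡.sym (share-* v 1≤depth)))

    1≤length-Ys : 1 ℕ.≤ length Ys
    1≤length-Ys = ℕₚ.n≢0⇒n>0 λ l≡0 → ℕₚ.<⇒≢ (f-positive v) (≡.trans (≡.cong (ℕ._* depth v) (≡.sym l≡0)) len)

    concat-perm : concat Xs ↭ concat Ys ++ concat Zs
    concat-perm = ↭-trans (concat-↭ perm) (↭-reflexive (≡.sym (Listₚ.concat-++ Ys Zs)))
      where
      concat-↭ : ∀ {Xs Ys : List Piece} → Xs ↭ Ys → concat Xs ↭ concat Ys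
      concat-↭ _↭_.refl                 = ↭-refl
      concat-↭ (prep X p)               = Permₚ.++⁺ˡ X (concat-↭ p)
      concat-↭ (swap {xs} X Y p)             = ↭-trans (Permₚ.shifts X Y) (Permₚ.++⁺ˡ Y (Permₚ.++⁺ˡ X (concat-↭ p)))
      concat-↭ (_↭_.trans p q)          = ↭-trans (concat-↭ p) (concat-↭ q)

    value-split : ∀ i → V i (concat Xs) ≈ V i (concat Ys) + V i (concat Zs)
    value-split i = ≈trans (value-↭ i concat-perm) (value-++ i (concat Ys) (concat Zs))

    all-Xs : ∀ {P : Piece → Set} → All P Xs → All P Ys × All P Zs
    all-Xs ps = Allₚ.++⁻ Ys (Permₚ.All-resp-↭ perm ps)

    uncounted : ∀ {i} → ¬ (i ≼ v) → ¬ Counted us i v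
    uncounted ¬i≼v (inj₁ i≼v)       = ¬i≼v i≼v
    uncounted ¬i≼v (inj₂ (_ , v∉us)) = v∉us v∈us

    take-count : length Zs ≡ N! ℕ.+ ΣN.sumᴸ (map share vs)
    take-count = ℕₚ.+-cancelˡ-≡ (share v) _ _ (≡.trans (≡.cong (ℕ._+ length Zs) (≡.sym length-Ys))
      (≡.trans (≡.sym (≡.trans (Permₚ.↭-length perm) (Listₚ.length-++ Ys))) (≡.trans count
        (+-left-comm N! (share v) (ΣN.sumᴸ (map share vs))))))

    take-tiling : Tiling (concat Zs ++ flatten A′)
    take-tiling = tiling-↭ (↭-trans (Permₚ.++⁺ʳ (flatten A) (↭-trans concat-perm (Permₚ.++-comm (concat Ys) (concat Zs))))
      (↭-trans (Permₚ.++-assoc (concat Zs) (concat Ys) (flatten A)) (Permₚ.++⁺ˡ (concat Zs)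
        (↭-sym (flatten-update v (λ j j≢v → give-other (concat Ys) A j≢v) (give-same v (concat Ys) A)))))) tiling

    take-counted : ∀ i → i AncestorOf v → Φ us A′ i + V i (concat Zs) ≈ Φ us A i + V i (concat Xs)
    take-counted i iv = begin
      Φ us A′ i + V i (concat Zs)                    ≈⟨ +-congʳ (Φ-give i (inj₁ (inj₂ iv))) ⟩
      (V i (concat Ys) + Φ us A i) + V i (concat Zs)
        ≈⟨ solve 3 (λ y p z → (y :+ p) :+ z := p :+ (y :+ z)) ≈refl (V i (concat Ys)) (Φ us A i) (V i (concat Zs)) ⟩
      Φ us A i + (V i (concat Ys) + V i (concat Zs)) ≈⟨ +-congˡ (value-split i) ⟨
      Φ us A i + V i (concat Xs)                     ∎

    take-slicer : ∃ λ w → All (λ X → V u X ≈ w) Zs ×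
                  Φ us A′ u + V u (concat Zs) ≤ fromℕ (depth u ℕ.+ subtreeSize u) * (fromℕ N! * w)
    take-slicer = let (w , eqs , le) = slicer in w , proj₂ (all-Xs eqs) , ≤-respˡ-≈ (≈sym (take-counted u uv)) le

    Served : Fin n → List Piece → List (Fin n) → Shares n → Set
    Served i Xs vs A = ∃ λ m → All (λ X → V i X ≤ m) Xs ×
                  Φ us A i + fromℕ (N! ℕ.+ remaining i vs) * m ≤ coef us i * V i (A i)

    -- Her take `y` enters `Φ` once and the right side `depth v + 1` times. The `depth v` spare
    -- copies pay for the pieces charged: there are at most `f v` of these, which is `depth v` times
    -- the number taken, and each is worth at most the least piece taken.
    served-self : Served v Zs vs A′
    served-self = bound (threshold v Ys Zs 1≤length-Ys best)
      where
      bound : (∃ λ m → 0# ≤ m × All (λ Z → V v Z ≤ m) Zs × All (λ Y → m ≤ V v Y) Ys) → Served v Zs vs A′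
      bound (m , 0≤m , Zs≤ , ≤Ys) = m , Zs≤ , ≤-respˡ-≈ (+-congʳ (≈sym (Φ-give v (inj₁ (inj₁ refl)))))
          (≤-respʳ-≈ (*-cong (≈reflexive (≡.sym (coef-∈ v∈us))) (≈sym (value-give v v (concat Ys) A)))
            (shift (+-mono unserved-v taken) (solve 5 (λ y p d a r → (con ℤ.1ℤ :+ d) :* (y :+ a) :- (y :+ p :+ r) :=
               ((con ℤ.1ℤ :+ d) :* a :+ d :* y) :- (p :+ r)) ≈refl y (Φ us A v) (fromℕ (depth v)) (V v (A v))
               (fromℕ (N! ℕ.+ remaining v vs) * m))))
        where
        y : ℝ
        y = V v (concat Ys)
        unserved-v : Φ us A v ≤ (1# + fromℕ (depth v)) * V v (A v)
        unserved-v = ≤-respʳ-≈ (*-congʳ (≈reflexive (coef-∈ v∈us)))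
          (unserved v v≢u (λ vu → ancestor-irrefl (uv Plus.++ vu)) λ _ → here refl)
        taken : fromℕ (N! ℕ.+ remaining v vs) * m ≤ fromℕ (depth v) * y
        taken = ≤-trans (*-monoʳ 0≤m (fromℕ-mono (remaining-≤ v (AllPairs.tail unique))))
          (≤-trans (≤-reflexive (begin
            fromℕ (f v) * m                                  ≈⟨ *-congʳ (≈reflexive (≡.cong fromℕ len)) ⟨
            fromℕ (length Ys ℕ.* depth v) * m                ≈⟨ *-congʳ (fromℕ-* (length Ys) (depth v)) ⟩
            (fromℕ (length Ys) * fromℕ (depth v)) * m
              ≈⟨ solve 3 (λ l d m → (l :* d) :* m := d :* (l :* m)) ≈refl (fromℕ (length Ys)) (fromℕ (depth v)) m ⟩
            fromℕ (depth v) * (fromℕ (length Ys) * m)        ∎))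
          (*-monoˡ (fromℕ-nonNeg (depth v)) (value-concat-≥ v Ys ≤Ys)))

    -- If `v` is below `i`, the pieces move from the charge at price `m` into `Φ`, where they are
    -- worth no more than that. If not, neither the charge nor `Φ` changes: `v` is still
    -- unprocessed, hence not counted as an ancestor of `i` either.
    served-other : ∀ i → u AncestorOf i → i ≢ v → Served i Xs (v ∷ vs) A → Served i Zs vs A′
    served-other i ui i≢v (m , Xs≤ , le) = m , proj₂ (all-Xs Xs≤) ,
        ≤-respʳ-≈ (*-congˡ (value-≡ i (≡.sym (give-other (concat Ys) A i≢v)))) (≤-trans (byCases counted other) le)
      where
      Bound : Set
      Bound = Φ us A′ i + fromℕ (N! ℕ.+ remaining i vs) * m ≤ Φ us A i + fromℕ (N! ℕ.+ remaining i (v ∷ vs)) * m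

      other : ¬ (i AncestorOf v) → Bound
      other ¬iv = ≤-reflexive (+-cong (Φ-give-uncounted i (uncounted λ { (inj₁ v≡i) → i≢v (≡.sym v≡i) ; (inj₂ iv) → ¬iv iv }))
        (*-congʳ (≈reflexive (≡.cong (λ r → fromℕ (N! ℕ.+ (r ℕ.+ remaining i vs))) (≡.sym (ΣN.when-no (i ⋖? v) ¬iv))))))

      counted : i AncestorOf v → Bound
      counted iv = ≤-respˡ-≈ (+-congʳ (≈sym (Φ-give i (inj₁ (inj₂ iv)))))
        (shift (value-concat-≤ i Ys (proj₁ (all-Xs Xs≤))) (begin
          (Φ us A i + fromℕ (N! ℕ.+ remaining i (v ∷ vs)) * m) + - ((y + Φ us A i) + fromℕ (N! ℕ.+ remaining i vs) * m)
            ≈⟨ +-congʳ (+-congˡ (*-congʳ (≈trans (≈reflexive (≡.cong fromℕ share-first)) (fromℕ-+ (length Ys) (N! ℕ.+ remaining i vs))))) ⟩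
          (Φ us A i + (fromℕ (length Ys) + r) * m) + - ((y + Φ us A i) + r * m)
            ≈⟨ solve 5 (λ p l r m y → (p :+ (l :+ r) :* m) :- ((y :+ p) :+ r :* m) := l :* m :- y) ≈refl
                 (Φ us A i) (fromℕ (length Ys)) r m y ⟩
          fromℕ (length Ys) * m + - y ∎))
        where
        y r : ℝ
        y = V i (concat Ys)
        r = fromℕ (N! ℕ.+ remaining i vs)
        share-first : N! ℕ.+ remaining i (v ∷ vs) ≡ length Ys ℕ.+ (N! ℕ.+ remaining i vs)
        share-first = ≡.trans (≡.cong (λ s → N! ℕ.+ (s ℕ.+ remaining i vs)) (≡.trans (ΣN.when-yes (i ⋖? v) iv) (≡.sym length-Ys)))
          (+-left-comm N! (length Ys) (remaining i vs))

    taken : SharingInv u Zs vs us A′ k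
    taken = record
      { queue    = queue
      ; unique   = AllPairs.tail unique
      ; ordered  = AllPairs.tail ordered
      ; below    = below ∘ there
      ; count    = take-count
      ; tiling   = take-tiling
      ; cutCount = cutCount
      ; empty    = ≡.trans (give-other (concat Ys) A (v≢u ∘ ≡.sym)) empty
      ; slicer   = take-slicer
      ; ancestor = λ i iu → ≤-respʳ-≈ (*-congˡ (value-≡ i (≡.sym (give-other (concat Ys) A (ancestor-≢ iu)))))
          (≤-respˡ-≈ (≈sym (take-counted i (≼-ancestor-trans (inj₂ iu) uv))) (ancestor i iu))
      ; unserved = λ i i≢u ¬iu ui∈ → Fair-resp {us = us} {us′ = us} {A = A} {A′ = A′} {i = i}
          (≈sym (Φ-give-uncounted i (uncounted (λ i≼v → unrelated i i≢u ¬iu ui∈ i≼v)))) refl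
          (≡.sym (give-other (concat Ys) A λ { refl → v∉vs (ui∈ uv) }))
          (unserved i i≢u ¬iu (there ∘ ui∈))
      ; served   = λ i ui i∉vs → byCases {P = i ≡ v} (λ { refl → served-self })
          (λ i≢v → served-other i ui i≢v (served i ui λ i∈ → i∉vs (∈-strip i≢v i∈)))
      }
      where
      ancestor-≢ : ∀ {i} → i AncestorOf u → i ≢ v
      ancestor-≢ iu refl = ancestor-irrefl (ancestor-≼-trans iu (inj₂ uv))

      -- The order of the takers enters here. A vertex strictly between `u` and `v` has smaller
      -- depth than `v`, so it cannot still be waiting in `vs`.
      unrelated : ∀ i → i ≢ u → ¬ (i AncestorOf u) → (u AncestorOf i → i ∈ vs) → ¬ (i ≼ v)
      unrelated i i≢u ¬iu ui∈ (inj₁ refl) = v∉vs (ui∈ uv)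
      unrelated i i≢u ¬iu ui∈ (inj₂ iv) with ancestors-comparable uv iv
      ... | inj₁ (inj₁ u≡i) = i≢u (≡.sym u≡i)
      ... | inj₁ (inj₂ iu)  = ¬iu iu
      ... | inj₂ ui         = ℕₚ.<⇒≱ (ancestor-depth iv) (v-depth (ui∈ ui))

  module Keep {u Xs us A k} (inv : SharingInv u Xs [] us A k) where
    open SharingInv inv

    A′ : Shares n
    A′ = give u (concat Xs) A

    length-Xs : length Xs ≡ N!
    length-Xs = ≡.trans count (ℕₚ.+-identityʳ N!)

    -- For descendants of `u`, her share already counts but was empty until now; the `N!` pieces
    -- that `served` still charges are the ones she puts into it. For `u` and her ancestors the
    -- whole table was charged from the start. All others are unaffected.
    keep-fair : ∀ i → Fair us A′ i
    keep-fair i = byCases {P = i ≡ u} (λ { refl → self slicer }) λ i≢u →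
      byCases {P = i AncestorOf u} (λ iu → above i≢u iu) λ ¬iu →
      byCases {P = u AncestorOf i} (λ ui → descendant i≢u ui (served i ui λ ())) λ ¬ui →
        Fair-resp {us = us} {us′ = us} {A = A} {A′ = A′} {i = i}
          (≈sym (Φ-give-uncounted i λ { (inj₁ (inj₁ u≡i)) → i≢u (≡.sym u≡i) ; (inj₁ (inj₂ iu)) → ¬iu iu ; (inj₂ (ui , _)) → ¬ui ui }))
          refl (≡.sym (give-other (concat Xs) A i≢u)) (unserved i i≢u ¬iu (⊥-elim ∘ ¬ui))
      where
      self : (∃ λ w → All (λ X → V u X ≈ w) Xs ×
              Φ us A u + V u (concat Xs) ≤ fromℕ (depth u ℕ.+ subtreeSize u) * (fromℕ N! * w)) → Fair us A′ u
      self (w , eqs , le) = ≤-respˡ-≈ (≈trans (+-comm _ _) (≈sym (Φ-give u (inj₁ (inj₁ refl)))))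
        (≤-respʳ-≈ (*-cong (≈reflexive (≡.sym (coef-∉ (head-∉ queue)))) (begin
          fromℕ N! * w                      ≈⟨ *-congʳ (≈reflexive (≡.cong fromℕ length-Xs)) ⟨
          fromℕ (length Xs) * w             ≈⟨ value-concat u Xs eqs ⟨
          V u (concat Xs)                   ≈⟨ +-identityʳ _ ⟨
          V u (concat Xs) + 0#              ≈⟨ +-congˡ (value-≡ u empty) ⟨
          V u (concat Xs) + V u (A u)       ≈⟨ value-give u u (concat Xs) A ⟨
          V u (A′ u)                        ∎)) le)

      above : i ≢ u → i AncestorOf u → Fair us A′ i
      above i≢u iu = ≤-respˡ-≈ (≈trans (+-comm _ _) (≈sym (Φ-give i (inj₁ (inj₂ iu)))))
        (≤-respʳ-≈ (*-congˡ (value-≡ i (≡.sym (give-other (concat Xs) A i≢u)))) (ancestor i iu))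

      descendant : i ≢ u → u AncestorOf i → (∃ λ m → All (λ X → V i X ≤ m) Xs ×
                   Φ us A i + fromℕ (N! ℕ.+ remaining i []) * m ≤ coef us i * V i (A i)) → Fair us A′ i
      descendant i≢u ui (m , Xs≤ , le) = ≤-respˡ-≈ (≈trans (+-comm _ _) (≈sym (Φ-give i (inj₂ (ui , head-∉ queue)))))
        (≤-respʳ-≈ (*-congˡ (value-≡ i (≡.sym (give-other (concat Xs) A i≢u))))
          (≤-trans (+-mono ≤-refl (≤-respʳ-≈ (*-congʳ (≈reflexive (≡.cong fromℕ count))) (value-concat-≤ i Xs Xs≤))) le))

    kept : ReadyInv us A′ k
    kept = record
      { queue    = queue-tail queue
      ; tiling   = tiling-↭ (↭-sym (flatten-update u (λ j j≢u → give-other (concat Xs) A j≢u) (give-same u (concat Xs) A))) tiling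
      ; cutCount = cutCount
      ; fair     = keep-fair
      }

  -- The initial state, progress and termination of every execution

  byDepth-exists : (P : Fin n → Set) → ∃ (ByDepth T P)
  byDepth-exists P = sort (select P) , record
    { unique  = allPairs-↭ (λ x≢y y≡x → x≢y (≡.sym y≡x)) (↭-sym (sort-↭ (select P))) (Uniqueₚ.filter⁺ P? (Uniqueₚ.allFin⁺ n))
    ; exactly = λ v → mk⇔
        (λ v∈ → proj₂ (∈-filter⁻ P? {xs = allFin n} (Permₚ.∈-resp-↭ (sort-↭ (select P)) v∈)))
        (λ p → Permₚ.∈-resp-↭ (↭-sym (sort-↭ (select P))) (∈-filter⁺ P? (∈-allFin v) p))
    ; ordered = Linked⇒AllPairs ℕₚ.≤-trans (sort-↗ (select P))
    }
    where
    open Sort (On.decTotalOrder ℕₚ.≤-decTotalOrder depth) using (sort; sort-↭; sort-↗)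
    P? : ∀ i → Dec (P i)
    P? i = lem {P i}

  initial : ∀ {us} → ByDepth T (λ _ → ⊤) us → ReadyInv us (give root (whole ∷ []) nothingShared) 0
  initial {us} byDepth = record
    { queue    = record { unique = unique ; ordered = ordered ; closed = λ {_} {w} _ _ → Equivalence.from (exactly w) tt }
    ; tiling   = tiling-↭ (↭-sym (↭-trans
        (flatten-update root (λ j j≢ → give-other (whole ∷ []) nothingShared j≢) (give-same root (whole ∷ []) nothingShared))
        (↭-reflexive (≡.cong (whole ∷_) flatten-nothing)))) tiling-whole
    ; cutCount = ℕₚ.*-monoˡ-≤ (n ℕ.* N!) length≤n
    ; fair     = λ i → byCases {P = i ≡ root} (λ { refl → root-fair }) (other-fair i)
    }
    where
    open ByDepth byDepth

    A : Shares n
    A = give root (whole ∷ []) nothingShared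

    flatten-nothing : flatten nothingShared ≡ []
    flatten-nothing = go n
      where
      go : ∀ m → flatten {n = m} (λ _ → []) ≡ []
      go zero    = refl
      go (suc m) = go m

    length≤n : length us ℕ.≤ n
    length≤n = ℕₚ.≤-trans (ℕₚ.≤-reflexive (length-sum us)) (ℕₚ.≤-trans (sumᴸ-≤-sum (λ _ → 1) unique) (ℕₚ.≤-reflexive (sum-one n)))

    Φ-nothing : ∀ i → Φ us nothingShared i ≈ 0#
    Φ-nothing i = ΣR.sum-0 λ j → ΣR.when-0 (lem {Counted us i j}) ≈refl

    root-fair : Fair us A root
    root-fair = ≤-reflexive (begin
      Φ us A root                        ≈⟨ Φ-give root (inj₁ (inj₁ refl)) ⟩
      V root (whole ∷ []) + Φ us nothingShared root ≈⟨ +-congˡ (Φ-nothing root) ⟩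
      V root (whole ∷ []) + 0#           ≈⟨ value-give root root (whole ∷ []) nothingShared ⟨
      V root (A root)                    ≈⟨ solve 1 (λ x → x := (con ℤ.1ℤ :+ con ℤ.0ℤ) :* x) ≈refl (V root (A root)) ⟩
      (1# + 0#) * V root (A root)        ≈⟨ *-congʳ (≈reflexive (≡.trans (coef-∈ (Equivalence.from (exactly root) tt))
                                              (≡.cong (fromℕ ∘ suc) depth-root))) ⟨
      coef us root * V root (A root)     ∎)

    -- The root is still unprocessed, so its cake counts for no other vertex, and both sides are 0.
    other-fair : ∀ i → i ≢ root → Fair us A i
    other-fair i i≢root = ≤-reflexive (begin
      Φ us A i               ≈⟨ Φ-give-uncounted i (λ { (inj₁ (inj₁ root≡i)) → i≢root (≡.sym root≡i)
                                                       ; (inj₁ (inj₂ ir)) → root-no-ancestor ir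
                                                       ; (inj₂ (_ , r∉)) → r∉ (Equivalence.from (exactly root) tt) }) ⟩
      Φ us nothingShared i   ≈⟨ Φ-nothing i ⟩
      0#                     ≈⟨ zeroʳ _ ⟨
      coef us i * 0#         ≈⟨ *-congˡ (value-≡ i (give-other (whole ∷ []) nothingShared i≢root)) ⟨
      coef us i * V i (A i)  ∎)

  Output : State → Set
  Output s = ∃₂ λ A k → s ≡ ready [] A k × ReadyInv [] A k

  -- The run after the table is cleared is passed in as an argument, which makes this recursion
  -- structural in `vs` and that of `run` structural in `us`. No taker gets stuck: by `count` the
  -- table holds the shares of all who wait.
  share-all : ∀ u vs us → (∀ {A k} → ReadyInv us A k → Inevitably _⟶_ Output (ready us A k)) →
              ∀ {Xs A k} → SharingInv u Xs vs us A k → Inevitably _⟶_ Output (sharing u Xs vs us A k)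
  share-all u []       us run inv = later (_ , keep) λ { _ keep → run (Keep.kept inv) }
  share-all u (v ∷ vs) us run {Xs} {A} {k} inv = later (step (mostValuable v (share v) Xs share≤))
    λ { _ (take perm len best) → share-all u vs us run (Take.taken inv perm len best) }
    where
    open SharingInv inv
    share≤ : share v ℕ.≤ length Xs
    share≤ = ℕₚ.≤-trans (ℕₚ.≤-trans (ℕₚ.m≤m+n (share v) (ΣN.sumᴸ (map share vs))) (ℕₚ.m≤n+m _ N!)) (ℕₚ.≤-reflexive (≡.sym count))
    step : (∃₂ λ Ys Zs → Xs ↭ Ys ++ Zs × length Ys ≡ share v × All (λ Y → All (λ Z → V v Z ≤ V v Y) Zs) Ys) →
           ∃ (sharing u Xs (v ∷ vs) us A k ⟶_)
    step (Ys , Zs , perm , len , best) = _ , take perm (≡.trans (≡.cong (ℕ._* depth v) len)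
      (share-* v (ℕₚ.≤-trans (ℕ.s≤s ℕ.z≤n) (ancestor-depth (below (here refl)))))) best

  run : ∀ us {A k} → ReadyInv us A k → Inevitably _⟶_ Output (ready us A k)
  run []       inv = now (_ , _ , refl , inv)
  run (u ∷ us) {A} {k} inv = later (step (slicesExist u (A u) (ℕ.pred (f u))) (byDepth-exists (u AncestorOf_)))
    λ { _ (slice cuts m<f perm len equal byDepth) →
          share-all u _ us (run us) (Slice.sliced inv cuts m<f perm len equal byDepth) }
    where
    f≡ : suc (ℕ.pred (f u)) ≡ f u
    f≡ = ℕₚ.suc-pred (f u) {{ℕ.>-nonZero (f-positive u)}}
    step : (∃ λ m → ∃₂ λ Y Xs → Cuts m (A u) Y × m ℕ.< suc (ℕ.pred (f u)) × concat Xs ↭ Y × length Xs ≡ suc (ℕ.pred (f u)) ×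
            (∃ λ w → All (λ X → V u X ≈ w) Xs)) → ∃ (ByDepth T (u AncestorOf_)) → ∃ (ready (u ∷ us) A k ⟶_)
    step (m , Y , Xs , cuts , m< , perm , len , equal) (vs , byDepth) =
      _ , slice cuts (≡.subst (m ℕ.<_) f≡ m<) perm (≡.trans len f≡) equal byDepth

  execution : Inevitably _⟶_ Output start
  execution = later (_ , begin-execution (proj₂ (byDepth-exists (λ _ → ⊤))))
    λ { _ (begin-execution byDepth) → run _ (initial byDepth) }

  -- From the final invariant to allocation, proportionality and number of cuts

  module _ {G : SimpleGraph n} (desc : IsDescendantGraph G T) {A : Shares n} {k : ℕ} (inv : ReadyInv [] A k) where
    open ReadyInv inv
    open SimpleGraph G using (_~_)
    open IsDescendantGraph desc

    neighbours : Fin n → List (Fin n)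
    neighbours i = select (λ j → i ~ j)

    neighbourCount : ∀ i → suc (length (neighbours i)) ≡ depth i ℕ.+ subtreeSize i
    neighbourCount i = ≡.trans (≡.cong suc (≡.trans (length-select (λ j → i ~ j)) (≡.trans
        (sum-cong-≗ (λ j → ΣN.when-⊎ (j ⋖? i) (i ⋖? j) (lem {i ~ j}) 1 ([ inj₂ , inj₁ ]′ ∘ Equivalence.to (edges i j))
          (Equivalence.from (edges i j) ∘ [ inj₂ , inj₁ ]′)
          λ (ji , ij) → ancestor-irrefl (ancestor-≼-trans ij (inj₂ ji))))
        (≡.trans (∑-distrib-+ (λ j → ΣN.when (j ⋖? i) 1) (λ j → ΣN.when (i ⋖? j) 1)) (≡.cong (ℕ._+ descendants i) (ancestorCount i))))))
      (≡.sym (≡.trans (≡.cong (depth i ℕ.+_) (subtreeSize-suc i)) (ℕₚ.+-suc (depth i) (descendants i))))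
      where open import Algebra.Properties.CommutativeMonoid.Sum ℕₚ.+-0-commutativeMonoid

    -- With nobody left to process, every ancestor counts, so the vertices counted for `i` are `i`
    -- itself and its neighbours.
    Φ-neighbours : ∀ i → Φ [] A i ≈ V i (A i) + sum (map (λ j → V i (A j)) (neighbours i))
    Φ-neighbours i = ≈trans (ΣR.sum-update i
      (λ j j≢i → ΣR.when-cong lem lem
        (λ { (inj₁ (inj₁ j≡i)) → ⊥-elim (j≢i j≡i) ; (inj₁ (inj₂ ij)) → Equivalence.from (edges i j) (inj₁ ij)
           ; (inj₂ (ji , _)) → Equivalence.from (edges i j) (inj₂ ji) })
        (λ i~j → [ inj₁ ∘ inj₂ , (λ ji → inj₂ (ji , λ ())) ]′ (Equivalence.to (edges i j) i~j)) λ _ → ≈refl)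
      (≈trans (ΣR.when-yes lem (inj₁ (inj₁ refl))) (≈trans (≈sym (+-identityʳ _)) (+-congˡ (≈sym (ΣR.when-no lem (SimpleGraph.irrefl G)))))))
      (+-congˡ (≈sym (ΣR.sumᴸ-filter (λ j → lem {i ~ j}) (λ j → V i (A j)) (λ j → j))))

    -- The invariant bounds her own share plus those of the `L` neighbours by `1# + L` times her
    -- own; one copy of it is subtracted from both sides.
    proportional : ProportionalOn G D A
    proportional i nonempty = *-cancelˡ-≤ 0<L (≤-respˡ-≈ (begin
        S                ≈⟨ *-identityˡ S ⟨
        1# * S           ≈⟨ *-congʳ (≈trans (*-comm L (L ⁻¹)) (*-inverseˡ 0<L)) ⟨
        (L * L ⁻¹) * S   ≈⟨ *-assoc L (L ⁻¹) S ⟩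
        L * (L ⁻¹ * S)   ∎)
      (shift (fair i) (begin
        L * V i (A i) + - S
          ≈⟨ solve 3 (λ l a s → l :* a :- s := (con ℤ.1ℤ :+ l) :* a :- (a :+ s)) ≈refl L (V i (A i)) S ⟩
        (1# + L) * V i (A i) + - (V i (A i) + S)
          ≈⟨ +-cong (*-congʳ (≈reflexive (≡.trans (≡.cong fromℕ (neighbourCount i)) (≡.sym (coef-∉ {[]} λ ())))))
                    (-‿cong (≈sym (Φ-neighbours i))) ⟩
        coef [] i * V i (A i) + - Φ [] A i ∎)))
      where
      L S : ℝ
      L = fromℕ (length (neighbours i))
      S = sum (map (λ j → V i (A j)) (neighbours i))
      length-positive : ∀ {xs : List (Fin n)} → xs ≢ [] → 0# < fromℕ (length xs)
      length-positive {[]}     ≢[] = ⊥-elim (≢[] refl)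
      length-positive {x ∷ xs} _   = fromℕ-positive (length xs)
      0<L : 0# < L
      0<L = length-positive nonempty

    outcome : IsAllocation A × ProportionalOn G D A × k ℕ.≤ n ^ 2 ℕ.* treeDepth !
    outcome = tiling-isAllocation A tiling , proportional ,
      ℕₚ.≤-trans (ℕₚ.≤-reflexive (≡.sym (ℕₚ.+-identityʳ k))) (ℕₚ.≤-trans cutCount (ℕₚ.≤-reflexive
        (ℕSolver.+-*-Solver.solve 2 (λ a b → a ⊛ (a ⊛ b) ⊜ (a ⊛ (a ⊛ con₁ 1)) ⊛ b) refl n N!)))
      where open ℕSolver.+-*-Solver using () renaming (_:*_ to _⊛_; _:=_ to _⊜_; con to con₁)

inevitably-map : {S : Set} {_⟶_ : S → S → Set} {P Q : S → Set} {s : S} → (∀ {s} → P s → Q s) →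
                 Inevitably _⟶_ P s → Inevitably _⟶_ Q s
inevitably-map h (now p)         = now (h p)
inevitably-map h (later next go) = later next λ s s⟶ → inevitably-map h (go s s⟶)

theorem4 : (lem : ExcludedMiddle 0ℓ) (𝓡 : CompleteOrderedField) →
    let open CakeCutting lem 𝓡 in
    (n : ℕ) (G : SimpleGraph n) (T : RootedTree n) → IsDescendantGraph G T →
    (D : Fin n → Density) →
    let open AlgDescendantGraph T D in
    Ensures (λ A k → IsAllocation A × ProportionalOn G D A × k ℕ.≤ n ^ 2 ℕ.* RootedTree.treeDepth T !)
theorem4 lem 𝓡 n G T desc D = inevitably-map (λ (A , k , eq , inv) → A , k , eq , outcome desc inv) execution
  where open Execution lem 𝓡 T D
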